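{- Let $\Delta$ be a finite $(d-1)$-dimensional simplicial complex, let $P$ be the poset of nonempty faces of $\Delta$ ordered by inclusion, and let $r\geq 1$. Let $\mathcal{C}^r(\Delta)$ be the clique complex of the graph on the set $P_r$ of $r$-multichains $A_1\subseteq A_2\subseteq\cdots\subseteq A_r$ of nonempty faces of $\Delta$, in which two distinct multichains $\mathfrak{p}=(p_1\subseteq\cdots\subseteq p_r)$ and $\mathfrak{q}=(q_1\subseteq\cdots\subseteq q_r)$ are adjacent iff $\mathfrak{p}\preceq_I\mathfrak{q}$ or $\mathfrak{q}\preceq_I\mathfrak{p}$, where $\mathfrak{p}\preceq_I\mathfrak{q}$ means $p_t\supseteq q_s$ for all $s\leq t-1$ and $p_t\subseteq q_s$ for all $s\geq t$ (for all $t,s\in[r]$). Then for $0\leq k\leq d-1$, $$f_k(\mathcal{C}^r(\Delta))=\sum_{l=0}^{d}\sum_{i=0}^{k}(-1)^{k-i}\binom{k}{i}\big[(r+ri)^l-(r+ri-1)^l\big]f_{l-1}(\Delta),$$ and $f_{ -1}(\mathcal{C}^r(\Delta))=f_{ -1}(\Delta)=1$.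
   Context: $f_i(\Gamma)$ denotes the number of $i$-dimensional faces (faces of cardinality $i+1$) of a simplicial complex $\Gamma$, with $f_{ -1}=1$. The relation $\preceq_I$ is the relation $\preceq_\imath$ for $\imath(t)=2t-1$, where in general $\mathfrak{p}\preceq_\imath\mathfrak{q}$ iff $p_t\geq q_s$ for $s\leq\imath(t)-t$ and $p_t\leq q_s$ for $s>\imath(t)-t$. Convention $0^0=1$. -}

module Defs where

open import Data.Bool using (Bool; true; false; _∧_; _∨_; not; T)
open import Data.Nat as ℕ using (ℕ; zero; suc; _≤_; _<_; _∸_)
open import Data.Nat.Combinatorics using (_C_)
open import Data.Fin using (Fin; toℕ)
open import Data.Fin.Subset using (Subset; _⊆_; ∣_∣; Nonempty)
open import Data.Fin.Subset.Properties using (_⊆?_; nonempty?)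
open import Data.Vec using (Vec; []; _∷_; lookup)
open import Data.Vec.Properties using (≡-dec)
open import Data.List using (List; []; _∷_; [_]; map; concatMap; allFin; length)
open import Data.Product using (Σ; ∃; _×_)
open import Data.Integer as ℤ using (ℤ; +_)
import Data.Bool.Properties as BoolP
open import Relation.Nullary.Decidable using (⌊_⌋)

all : {A : Set} → (A → Bool) → List A → Bool
all p []       = true
all p (x ∷ xs) = p x ∧ all p xs

allSubsets : (n : ℕ) → List (Subset n)
allSubsets zero    = [ [] ]
allSubsets (suc n) = concatMap (λ s → (true ∷ s) ∷ (false ∷ s) ∷ []) (allSubsets n)

allVecs : {A : Set} → (r : ℕ) → List A → List (Vec A r)
allVecs zero    xs = [ [] ]
allVecs (suc r) xs = concatMap (λ x → map (x ∷_) (allVecs r xs)) xs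

-- all sublists (= subsets, when the list has no duplicates)
sublists : {A : Set} → List A → List (List A)
sublists []       = [ [] ]
sublists (x ∷ xs) = let ys = sublists xs in concatMap (λ s → (x ∷ s) ∷ s ∷ []) ys

countᵇ : {A : Set} → (A → Bool) → List A → ℕ
countᵇ p []       = 0
countᵇ p (x ∷ xs) with p x
... | true  = suc (countᵇ p xs)
... | false = countᵇ p xs

allPairsᵇ : {A : Set} → (A → A → Bool) → List A → Bool
allPairsᵇ R []       = true
allPairsᵇ R (x ∷ xs) = all (R x) xs ∧ allPairsᵇ R xs

sumTo : ℕ → (ℕ → ℤ) → ℤ
sumTo zero    g = g 0
sumTo (suc m) g = sumTo m g ℤ.+ g (suc m)

record SimplicialComplex (n : ℕ) : Set where
  field
    isFace      : Subset n → Bool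
    downClosed  : ∀ σ τ → τ ⊆ σ → T (isFace σ) → T (isFace τ)
open SimplicialComplex public

HasDimMinusOne : {n : ℕ} → SimplicialComplex n → ℕ → Set
HasDimMinusOne {n} Δ d =
  (∃ λ σ → T (isFace Δ σ) × ∣ σ ∣ ≡ d) × (∀ σ → T (isFace Δ σ) → ∣ σ ∣ ≤ d)
  where open import Relation.Binary.PropositionalEquality using (_≡_)

-- fCard Δ l = f_{l-1}(Δ) = number of faces of Δ of cardinality l
fCard : {n : ℕ} → SimplicialComplex n → ℕ → ℕ
fCard {n} Δ l = countᵇ (λ σ → isFace Δ σ ∧ ⌊ ∣ σ ∣ ℕ.≟ l ⌋) (allSubsets n)

Multichain : ℕ → ℕ → Set
Multichain n r = Vec (Subset n) r

isMultichain : {n r : ℕ} → SimplicialComplex n → Multichain n r → Bool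
isMultichain {n} {r} Δ A =
  all (λ t → isFace Δ (lookup A t) ∧ ⌊ nonempty? (lookup A t) ⌋) (allFin r)
  ∧ all (λ s → all (λ t → not ⌊ toℕ s ℕ.≤? toℕ t ⌋ ∨ ⌊ lookup A s ⊆? lookup A t ⌋)
                   (allFin r)) (allFin r)

multichains : {n : ℕ} → SimplicialComplex n → (r : ℕ) → List (Multichain n r)
multichains {n} Δ r = Data.List.filterᵇ (isMultichain Δ) (allVecs r (allSubsets n))
  where import Data.List

precI : {n r : ℕ} → Multichain n r → Multichain n r → Bool
precI {n} {r} p q =
  all (λ t → all (λ s →
        (not ⌊ toℕ s ℕ.<? toℕ t ⌋ ∨ ⌊ lookup q s ⊆? lookup p t ⌋)
      ∧ (not ⌊ toℕ t ℕ.≤? toℕ s ⌋ ∨ ⌊ lookup p t ⊆? lookup q s ⌋))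
    (allFin r)) (allFin r)

adjacent : {n r : ℕ} → Multichain n r → Multichain n r → Bool
adjacent p q = not ⌊ ≡-dec (≡-dec BoolP._≟_) p q ⌋ ∧ (precI p q ∨ precI q p)

-- fCliqueCard Δ r j = number of faces of cardinality j of the clique
-- complex C^r(Δ), i.e. f_{j-1}(C^r(Δ))
fCliqueCard : {n : ℕ} → SimplicialComplex n → (r : ℕ) → ℕ → ℕ
fCliqueCard Δ r j =
  countᵇ (λ S → ⌊ length S ℕ.≟ j ⌋ ∧ allPairsᵇ adjacent S) (sublists (multichains Δ r))

rhs : {n : ℕ} → SimplicialComplex n → (d r k : ℕ) → ℤ
rhs Δ d r k =
  sumTo d (λ l → sumTo k (λ i →
    ((ℤ.- (+ 1)) ℤ.^ (k ∸ i)) ℤ.* (+ (k C i))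
      ℤ.* ((+ ((r ℕ.+ r ℕ.* i) ℕ.^ l)) ℤ.- (+ ((r ℕ.+ r ℕ.* i ∸ 1) ℕ.^ l)))
      ℤ.* (+ fCard Δ l)))

{-# OPTIONS --safe #-}

-- If 𝔭 ⪯ 𝔮 then 𝔭 is contained in 𝔮 entrywise, and the enumeration of the multichains
-- puts entrywise larger ones first.  Hence cliques are exactly the sublists on which each
-- element is ⪯ every earlier one.  Compare them with weak chains, sequences with
-- repetition of the same kind: the k-th forward difference at 0 of j ↦ #(weak chains of
-- length j + 1) is the number of cliques of size k + 1.  The signed binomial sum of the
-- theorem is this k-th difference.
--
-- Once the first (largest) member x of a weak chain is fixed, the t-th entries of the
-- later members form a decreasing sequence between xₜ₋₁ and xₜ, independently for the
-- different t.  So the number of weak chains from x is a product over t of values of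
-- iterates of the operator (Z f)(x) = Σ_{y ⊆ x} f(y), which maps a^|·| to (a+1)^|·|.
-- Summing over x gives N^|σ| - (N-1)^|σ| for each face σ = xᵣ, with N = r (j + 1).
module Submission where

open import Defs
open import Data.Bool using (Bool; true; false; _∧_; _∨_; not; T)
open import Data.Bool.Properties using (T-∧; T-∨; T-≡)
import Data.Bool.Properties as Boolₚ
open import Data.Empty using (⊥-elim)
open import Data.Fin using (Fin; zero; suc; toℕ; fromℕ)
open import Data.Fin.Properties using (≤fromℕ; toℕ-injective)
open import Data.Fin.Subset using (Subset; _∈_; _⊆_; ∣_∣; Nonempty; ⊥)
open import Data.Fin.Subset.Properties
  using (_⊆?_; nonempty?; ⊆-refl; ⊆-trans; ⊆-antisym; ⊥⊆; ∣⊥∣≡0; drop-∷-⊆)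
open import Data.Nat as ℕ using (ℕ; zero; suc; _≤_; _<_; z≤n; s≤s; _∸_)
import Data.Nat.Properties as ℕₚ
open import Data.Nat.Combinatorics using (_C_; nCk+nC[k+1]≡[n+1]C[k+1]; k>n⇒nCk≡0)
open import Data.Integer as ℤ using (ℤ; +_; _+_; _*_; _-_; -_; 0ℤ; 1ℤ; -1ℤ; _^_)
open import Data.Integer.Properties hiding (≤-refl; ≤-trans; _≟_; _≤?_; _<?_)
open import Data.Integer.Tactic.RingSolver using (solve-∀)
open import Data.List using (List; []; _∷_; _++_; map; concatMap; filterᵇ; length; allFin)
open import Data.List.Properties using (length-filter; filter-all)
open import Data.List.Membership.Propositional.Properties using (∈-allFin)
open import Data.List.Relation.Unary.All as All using (All; []; _∷_)
import Data.List.Relation.Unary.All.Properties as Allₚ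
open import Data.List.Relation.Unary.AllPairs as AllPairs using (AllPairs; []; _∷_)
import Data.List.Relation.Unary.AllPairs.Properties as AllPairsₚ
open import Data.Product using (_×_; _,_; proj₁; proj₂)
open import Data.Sum using (_⊎_; inj₁; inj₂)
open import Data.Unit using (tt)
open import Data.Vec using (Vec; []; _∷_; lookup; here; there)
open import Data.Vec.Properties using (≡-dec)
open import Function using (_∘_; Equivalence)
open import Relation.Nullary using (¬_; Dec; yes; no; contradiction)
open import Relation.Nullary.Decidable
  using (⌊_⌋; isYes≗does; T?; toWitness; fromWitness; fromWitnessFalse)
open import Relation.Binary.PropositionalEquality
open ≡-Reasoning

open Equivalence using (to; from)

private variable
  A B : Set
  n r : ℕ

-- Finite sums of integers over lists

∑ : List A → (A → ℤ) → ℤ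
∑ []       f = 0ℤ
∑ (x ∷ xs) f = f x + ∑ xs f

∑-cong-All : ∀ {xs : List A} {f g : A → ℤ} → All (λ x → f x ≡ g x) xs → ∑ xs f ≡ ∑ xs g
∑-cong-All []       = refl
∑-cong-All (e ∷ es) = cong₂ _+_ e (∑-cong-All es)

∑-cong : ∀ (xs : List A) {f g : A → ℤ} → (∀ x → f x ≡ g x) → ∑ xs f ≡ ∑ xs g
∑-cong xs f≗g = ∑-cong-All (All.universal f≗g xs)

∑-zero : ∀ (xs : List A) → ∑ xs (λ _ → 0ℤ) ≡ 0ℤ
∑-zero []       = refl
∑-zero (x ∷ xs) = trans (+-identityˡ _) (∑-zero xs)

∑-+ : ∀ (xs : List A) (f g : A → ℤ) → ∑ xs (λ x → f x + g x) ≡ ∑ xs f + ∑ xs g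
∑-+ []       f g = refl
∑-+ (x ∷ xs) f g = trans (cong (_+_ (f x + g x)) (∑-+ xs f g)) (interchange (f x) (g x) _ _)
  where
  interchange : ∀ a b c d → a + b + (c + d) ≡ a + c + (b + d)
  interchange = solve-∀

∑-*ˡ : ∀ c (xs : List A) (f : A → ℤ) → ∑ xs (λ x → c * f x) ≡ c * ∑ xs f
∑-*ˡ c []       f = sym (*-zeroʳ c)
∑-*ˡ c (x ∷ xs) f = trans (cong (_+_ (c * f x)) (∑-*ˡ c xs f)) (sym (*-distribˡ-+ c (f x) _))

∑-*ʳ : ∀ c (xs : List A) (f : A → ℤ) → ∑ xs (λ x → f x * c) ≡ ∑ xs f * c
∑-*ʳ c xs f = trans (∑-cong xs λ x → *-comm (f x) c) (trans (∑-*ˡ c xs f) (*-comm c _))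

∑-- : ∀ (xs : List A) (f g : A → ℤ) → ∑ xs (λ x → f x - g x) ≡ ∑ xs f - ∑ xs g
∑-- xs f g = begin
  ∑ xs (λ x → f x - g x)           ≡⟨ ∑-+ xs f (-_ ∘ g) ⟩
  ∑ xs f + ∑ xs (-_ ∘ g)           ≡⟨ cong (_+_ (∑ xs f)) (∑-cong xs (λ x → sym (-1*i≡-i (g x)))) ⟩
  ∑ xs f + ∑ xs (λ x → -1ℤ * g x)  ≡⟨ cong (_+_ (∑ xs f)) (trans (∑-*ˡ -1ℤ xs g) (-1*i≡-i _)) ⟩
  ∑ xs f - ∑ xs g                  ∎

∑-swap : ∀ (xs : List A) (ys : List B) (f : A → B → ℤ) →
         ∑ xs (λ x → ∑ ys (f x)) ≡ ∑ ys (λ y → ∑ xs (λ x → f x y))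
∑-swap []       ys f = sym (∑-zero ys)
∑-swap (x ∷ xs) ys f = trans (cong (_+_ (∑ ys (f x))) (∑-swap xs ys f)) (sym (∑-+ ys (f x) _))

∑-++ : ∀ (xs ys : List A) (f : A → ℤ) → ∑ (xs ++ ys) f ≡ ∑ xs f + ∑ ys f
∑-++ []       ys f = sym (+-identityˡ _)
∑-++ (x ∷ xs) ys f = trans (cong (_+_ (f x)) (∑-++ xs ys f)) (sym (+-assoc (f x) _ _))

∑-map : ∀ (g : A → B) (xs : List A) (f : B → ℤ) → ∑ (map g xs) f ≡ ∑ xs (f ∘ g)
∑-map g []       f = refl
∑-map g (x ∷ xs) f = cong (_+_ (f (g x))) (∑-map g xs f)

∑-concatMap : ∀ (g : A → List B) (xs : List A) (f : B → ℤ) →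
              ∑ (concatMap g xs) f ≡ ∑ xs (λ x → ∑ (g x) f)
∑-concatMap g []       f = refl
∑-concatMap g (x ∷ xs) f = trans (∑-++ (g x) _ f) (cong (_+_ (∑ (g x) f)) (∑-concatMap g xs f))

∑-allVecs : ∀ r (xs : List A) (f : Vec A (suc r) → ℤ) →
            ∑ (allVecs (suc r) xs) f ≡ ∑ xs (λ x → ∑ (allVecs r xs) (λ v → f (x ∷ v)))
∑-allVecs r xs f = trans (∑-concatMap _ xs f) (∑-cong xs λ x → ∑-map (x ∷_) (allVecs r xs) f)

-- Indicators, counting and filtering

⟦_⟧ : Bool → ℤ
⟦ true  ⟧ = 1ℤ
⟦ false ⟧ = 0ℤ

⟦⟧-∧ : ∀ a b → ⟦ a ∧ b ⟧ ≡ ⟦ a ⟧ * ⟦ b ⟧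
⟦⟧-∧ true  b = sym (*-identityˡ _)
⟦⟧-∧ false b = refl

⟦⟧-*-cong : ∀ b {x y} → (b ≡ true → x ≡ y) → ⟦ b ⟧ * x ≡ ⟦ b ⟧ * y
⟦⟧-*-cong true  e = cong (1ℤ *_) (e refl)
⟦⟧-*-cong false e = refl

count-∑ : ∀ (p : A → Bool) xs → + countᵇ p xs ≡ ∑ xs (⟦_⟧ ∘ p)
count-∑ p []       = refl
count-∑ p (x ∷ xs) with p x
... | true  = trans (pos-+ 1 (countᵇ p xs)) (cong (λ n → 1ℤ + n) (count-∑ p xs))
... | false = trans (count-∑ p xs) (sym (+-identityˡ _))

∑-filterᵇ : ∀ (p : A → Bool) xs (f : A → ℤ) → ∑ (filterᵇ p xs) f ≡ ∑ xs (λ x → ⟦ p x ⟧ * f x)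
∑-filterᵇ p []       f = refl
∑-filterᵇ p (x ∷ xs) f with p x
... | true  = cong₂ _+_ (sym (*-identityˡ (f x))) (∑-filterᵇ p xs f)
... | false = trans (∑-filterᵇ p xs f) (sym (+-identityˡ _))

filterᵇ-cong : ∀ {p q : A → Bool} {xs} → All (λ x → p x ≡ q x) xs → filterᵇ p xs ≡ filterᵇ q xs
filterᵇ-cong [] = refl
filterᵇ-cong {p = p} {q} {x ∷ xs} (e ∷ es) with p x | q x
... | true  | true  = cong (x ∷_) (filterᵇ-cong es)
... | false | false = filterᵇ-cong es
filterᵇ-cong (() ∷ es) | true  | false
filterᵇ-cong (() ∷ es) | false | true

filterᵇ-filterᵇ : ∀ (p q : A → Bool) xs → filterᵇ q (filterᵇ p xs) ≡ filterᵇ (λ x → p x ∧ q x) xs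
filterᵇ-filterᵇ p q [] = refl
filterᵇ-filterᵇ p q (x ∷ xs) with p x
... | false = filterᵇ-filterᵇ p q xs
... | true with q x
...   | true  = cong (x ∷_) (filterᵇ-filterᵇ p q xs)
...   | false = filterᵇ-filterᵇ p q xs

-- Forward differences and cliques

diff₀ : ℕ → (ℕ → ℤ) → ℤ
diff₀ zero    g = g 0
diff₀ (suc k) g = diff₀ k (λ i → g (suc i) - g i)

diff₀-cong : ∀ k {g h : ℕ → ℤ} → (∀ i → g i ≡ h i) → diff₀ k g ≡ diff₀ k h
diff₀-cong zero    g≗h = g≗h 0
diff₀-cong (suc k) g≗h = diff₀-cong k λ i → cong₂ _-_ (g≗h (suc i)) (g≗h i)

diff₀-+ : ∀ k (g h : ℕ → ℤ) → diff₀ k (λ i → g i + h i) ≡ diff₀ k g + diff₀ k h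
diff₀-+ zero    g h = refl
diff₀-+ (suc k) g h = trans
  (diff₀-cong k λ i → rearrange (g (suc i)) (h (suc i)) (g i) (h i))
  (diff₀-+ k (λ i → g (suc i) - g i) (λ i → h (suc i) - h i))
  where
  rearrange : ∀ a b c d → a + b - (c + d) ≡ (a - c) + (b - d)
  rearrange = solve-∀

diff₀-zero : ∀ k → diff₀ k (λ _ → 0ℤ) ≡ 0ℤ
diff₀-zero zero    = refl
diff₀-zero (suc k) = diff₀-zero k

-- For `adjacent` on `multichains Δ r` this is `fCliqueCard Δ r j`, written as a sum of indicators
-- in ℤ so that differences make sense.
cliques : (A → A → Bool) → List A → ℕ → ℤ
cliques E L j = ∑ (sublists L) (λ s → ⟦ ⌊ length s ℕ.≟ j ⌋ ∧ allPairsᵇ E s ⟧)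

-- Counts sequences of length j in L in which every member is R-related to all later ones. The list
-- is filtered again at each step, so R need not be transitive, and a member with R x x may be
-- repeated.
weakChains : (A → A → Bool) → List A → ℕ → ℤ
weakChains R L zero    = 1ℤ
weakChains R L (suc j) = ∑ L (λ x → weakChains R (filterᵇ (R x) L) j)

∑-sublists-∷ : ∀ (x : A) xs (f : List A → ℤ) →
               ∑ (sublists (x ∷ xs)) f ≡ ∑ (sublists xs) (λ s → f (x ∷ s) + f s)
∑-sublists-∷ x xs f = trans (∑-concatMap _ (sublists xs) f)
  (∑-cong (sublists xs) λ s → cong (_+_ (f (x ∷ s))) (+-identityʳ (f s)))

∑-sublists-filterᵇ : ∀ (q : A → Bool) xs (f : List A → ℤ) →
  ∑ (sublists (filterᵇ q xs)) f ≡ ∑ (sublists xs) (λ s → ⟦ all q s ⟧ * f s)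
∑-sublists-filterᵇ q []       f = cong (_+ 0ℤ) (sym (*-identityˡ (f [])))
∑-sublists-filterᵇ q (x ∷ xs) f
  -- The right side is expanded first, so that the case split on `q x` also evaluates the indicator
  -- of `all q (x ∷ s)`.
  rewrite ∑-sublists-∷ x xs (λ s → ⟦ all q s ⟧ * f s) with q x
... | true  = begin
  ∑ (sublists (x ∷ filterᵇ q xs)) f
    ≡⟨ ∑-sublists-∷ x (filterᵇ q xs) f ⟩
  ∑ (sublists (filterᵇ q xs)) (λ s → f (x ∷ s) + f s)
    ≡⟨ ∑-sublists-filterᵇ q xs _ ⟩
  ∑ (sublists xs) (λ s → ⟦ all q s ⟧ * (f (x ∷ s) + f s))
    ≡⟨ ∑-cong (sublists xs) (λ s → *-distribˡ-+ ⟦ all q s ⟧ (f (x ∷ s)) (f s)) ⟩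
  ∑ (sublists xs) (λ s → ⟦ all q s ⟧ * f (x ∷ s) + ⟦ all q s ⟧ * f s)
    ∎
... | false = trans (∑-sublists-filterᵇ q xs f)
  (∑-cong (sublists xs) λ s → sym (+-identityˡ _))

≟-suc : ∀ m n → ⌊ suc m ℕ.≟ suc n ⌋ ≡ ⌊ m ℕ.≟ n ⌋
≟-suc m n = trans (isYes≗does (suc m ℕ.≟ suc n)) (sym (isYes≗does (m ℕ.≟ n)))

-- Removing x from a clique through x leaves a clique, one smaller, among the E-neighbours of x; the
-- other cliques lie in xs.
cliques-∷ : ∀ (E : A → A → Bool) x xs j →
  cliques E (x ∷ xs) (suc j) ≡ cliques E (filterᵇ (E x) xs) j + cliques E xs (suc j)
cliques-∷ E x xs j = begin
  cliques E (x ∷ xs) (suc j)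
    ≡⟨ ∑-sublists-∷ x xs _ ⟩
  ∑ (sublists xs) (λ s → g (suc j) (x ∷ s) + g (suc j) s)
    ≡⟨ ∑-+ (sublists xs) (g (suc j) ∘ (x ∷_)) (g (suc j)) ⟩
  ∑ (sublists xs) (g (suc j) ∘ (x ∷_)) + cliques E xs (suc j)
    ≡⟨ cong (_+ cliques E xs (suc j)) (∑-cong (sublists xs) step) ⟩
  ∑ (sublists xs) (λ s → ⟦ all (E x) s ⟧ * g j s) + cliques E xs (suc j)
    ≡⟨ cong (_+ cliques E xs (suc j)) (∑-sublists-filterᵇ (E x) xs (g j)) ⟨
  cliques E (filterᵇ (E x) xs) j + cliques E xs (suc j)
    ∎
  where
  g : ℕ → List _ → ℤ
  g i s = ⟦ ⌊ length s ℕ.≟ i ⌋ ∧ allPairsᵇ E s ⟧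
  step : ∀ s → g (suc j) (x ∷ s) ≡ ⟦ all (E x) s ⟧ * g j s
  step s rewrite ≟-suc (length s) j with ⌊ length s ℕ.≟ j ⌋
  ... | true  = ⟦⟧-∧ (all (E x) s) _
  ... | false = sym (*-zeroʳ ⟦ all (E x) s ⟧)

cliques-zero : ∀ (E : A → A → Bool) xs → cliques E xs 0 ≡ 1ℤ
cliques-zero E []       = refl
cliques-zero E (x ∷ xs) = begin
  cliques E (x ∷ xs) 0
    ≡⟨ ∑-sublists-∷ x xs _ ⟩
  ∑ (sublists xs) (λ s → 0ℤ + ⟦ ⌊ length s ℕ.≟ 0 ⌋ ∧ allPairsᵇ E s ⟧)
    ≡⟨ ∑-cong (sublists xs) (λ s → +-identityˡ _) ⟩
  cliques E xs 0
    ≡⟨ cliques-zero E xs ⟩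
  1ℤ ∎

module _ {A : Set} (E R : A → A → Bool) where

  -- R x y can only hold when x is listed before y or equals y.
  Directed : List A → Set
  Directed L = All (λ x → R x x ≡ true) L × AllPairs (λ x y → E x y ≡ R x y × R y x ≡ false) L

  Directed-filterᵇ : ∀ (p : A → Bool) {L} → Directed L → Directed (filterᵇ p L)
  Directed-filterᵇ p (rs , ds) = Allₚ.filter⁺ (T? ∘ p) rs , AllPairsₚ.filter⁺ (T? ∘ p) ds

  -- Split by the first member. After x, reflexivity keeps x available. After some y in xs, x is
  -- excluded because R y x fails, so the whole chain stays in xs.
  weakChains-∷ : ∀ x xs j → Directed (x ∷ xs) → weakChains R (x ∷ xs) (suc j) ≡
    weakChains R xs (suc j) + weakChains R (x ∷ filterᵇ (R x) xs) j
  weakChains-∷ x xs j (r ∷ _ , d ∷ _) rewrite r = trans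
    (cong (_+_ (weakChains R (x ∷ filterᵇ (R x) xs) j))
      (∑-cong-All (All.map (λ {y} e → cong (λ L → weakChains R L j) (skip y (proj₂ e))) d)))
    (+-comm _ (weakChains R xs (suc j)))
    where
    skip : ∀ y → R y x ≡ false → filterᵇ (R y) (x ∷ xs) ≡ filterᵇ (R y) xs
    skip y e rewrite e = refl

  -- Both sides satisfy the same recursion on L: splitting off the first element x,
  -- a weak chain through x is a run of x's followed by a weak chain in the
  -- R-neighbours of x, so taking one difference removes x.
  diff₀-weakChains : ∀ m L → length L ≤ m → Directed L → ∀ k →
    diff₀ k (λ i → weakChains R L (suc i)) ≡ cliques E L (suc k)
  diff₀-weakChains m       []       l≤m dir k = diff₀-zero k
  diff₀-weakChains (suc m) (x ∷ xs) (s≤s l≤m) dir@(r ∷ rs , d ∷ ds) k = begin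
    diff₀ k (λ i → weakChains R (x ∷ xs) (suc i))
      ≡⟨ diff₀-cong k (λ i → weakChains-∷ x xs i dir) ⟩
    diff₀ k (λ i → weakChains R xs (suc i) + weakChains R (x ∷ F) i)
      ≡⟨ diff₀-+ k _ _ ⟩
    diff₀ k (λ i → weakChains R xs (suc i)) + diff₀ k (weakChains R (x ∷ F))
      ≡⟨ cong₂ _+_ (diff₀-weakChains m xs l≤m (rs , ds) k) (through-x k) ⟩
    cliques E xs (suc k) + cliques E F k
      ≡⟨ +-comm (cliques E xs (suc k)) _ ⟩
    cliques E F k + cliques E xs (suc k)
      ≡⟨ cong (λ L → cliques E L k + cliques E xs (suc k)) (filterᵇ-cong (All.map proj₁ d)) ⟨
    cliques E (filterᵇ (E x) xs) k + cliques E xs (suc k)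
      ≡⟨ cliques-∷ E x xs k ⟨
    cliques E (x ∷ xs) (suc k)
      ∎
    where
    F = filterᵇ (R x) xs
    dirF : Directed (x ∷ F)
    dirF = r ∷ proj₁ dF , Allₚ.filter⁺ (T? ∘ R x) d ∷ proj₂ dF
      where dF = Directed-filterᵇ (R x) (rs , ds)
    -- After an initial x, a weak chain in `x ∷ F` continues in the same list. Hence the recursion
    -- for `u` closes up, and its difference counts the weak chains that avoid x.
    F-idem : filterᵇ (R x) F ≡ F
    F-idem = filter-all (T? ∘ R x) (Allₚ.all-filter (T? ∘ R x) xs)
    u : ℕ → ℤ
    u = weakChains R (x ∷ F)
    u-step : ∀ i → u (suc i) - u i ≡ weakChains R F (suc i)
    u-step i = begin
      u (suc i) - u i
        ≡⟨ cong (_- u i) (weakChains-∷ x F i dirF) ⟩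
      weakChains R F (suc i) + weakChains R (x ∷ filterᵇ (R x) F) i - u i
        ≡⟨ cong (λ L → weakChains R F (suc i) + weakChains R (x ∷ L) i - u i) F-idem ⟩
      weakChains R F (suc i) + u i - u i
        ≡⟨ cancel (weakChains R F (suc i)) (u i) ⟩
      weakChains R F (suc i)
        ∎
      where
      cancel : ∀ a b → a + b - b ≡ a
      cancel = solve-∀
    -- For k = 0 the empty chain matches the empty clique. Otherwise one difference is spent on
    -- passing from `x ∷ F` to `F`. As `F` is no subterm of `x ∷ xs`, the recursion runs on the
    -- length bound m.
    through-x : ∀ k → diff₀ k u ≡ cliques E F k
    through-x zero    = sym (cliques-zero E F)
    through-x (suc k) = trans (diff₀-cong k u-step)
      (diff₀-weakChains m F (ℕₚ.≤-trans (length-filter (T? ∘ R x) xs) l≤m)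
        (Directed-filterᵇ (R x) (rs , ds)) k)

-- From Boolean tests to propositions

T⇔T⇒≡ : ∀ {a b} → (T a → T b) → (T b → T a) → a ≡ b
T⇔T⇒≡ {true}  {true}  f g = refl
T⇔T⇒≡ {false} {false} f g = refl
T⇔T⇒≡ {true}  {false} f g = ⊥-elim (f tt)
T⇔T⇒≡ {false} {true}  f g = ⊥-elim (g tt)

¬T⇒≡false : ∀ {a} → ¬ T a → a ≡ false
¬T⇒≡false {true}  f = ⊥-elim (f tt)
¬T⇒≡false {false} f = refl

T-all⁻ : ∀ {p : A → Bool} xs → T (all p xs) → All (T ∘ p) xs
T-all⁻ []       _ = []
T-all⁻ (x ∷ xs) h = proj₁ (to T-∧ h) ∷ T-all⁻ xs (proj₂ (to T-∧ h))

T-all⁺ : ∀ {p : A → Bool} {xs} → All (T ∘ p) xs → T (all p xs)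
T-all⁺ []       = tt
T-all⁺ (h ∷ hs) = from T-∧ (h , T-all⁺ hs)

T-allFin⁻ : ∀ {p : Fin r → Bool} → T (all p (allFin r)) → ∀ t → T (p t)
T-allFin⁻ h t = All.lookup (T-all⁻ _ h) (∈-allFin t)

T-allFin⁺ : ∀ {p : Fin r → Bool} → (∀ t → T (p t)) → T (all p (allFin r))
T-allFin⁺ h = T-all⁺ (All.universal h (allFin _))

T-⇒⁻ : ∀ {P Q : Set} (p? : Dec P) (q? : Dec Q) → T (not ⌊ p? ⌋ ∨ ⌊ q? ⌋) → P → Q
T-⇒⁻ (yes _) q? h _ = toWitness h
T-⇒⁻ (no ¬p) q? h p = contradiction p ¬p

T-⇒⁺ : ∀ {P Q : Set} (p? : Dec P) (q? : Dec Q) → (P → Q) → T (not ⌊ p? ⌋ ∨ ⌊ q? ⌋)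
T-⇒⁺ (yes p) q? h = fromWitness (h p)
T-⇒⁺ (no _)  q? h = tt

-- Interlacing and multichains as propositions

_≼_ : Vec (Subset n) r → Vec (Subset n) r → Set
x ≼ y = ∀ t → lookup x t ⊆ lookup y t

-- The lower bounds that `precI y x` imposes on y. For ascending x they reduce to xₜ₋₁ ⊆ yₜ.
_≪_ : Vec (Subset n) r → Vec (Subset n) r → Set
x ≪ y = ∀ s t → toℕ s < toℕ t → lookup x s ⊆ lookup y t

Ascending : Vec (Subset n) r → Set
Ascending x = ∀ s t → toℕ s ≤ toℕ t → lookup x s ⊆ lookup x t

precI⁻ : (p q : Vec (Subset n) r) → T (precI p q) →
         q ≪ p × (∀ t s → toℕ t ≤ toℕ s → lookup p t ⊆ lookup q s)
precI⁻ p q h =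
  (λ s t → T-⇒⁻ (toℕ s ℕ.<? toℕ t) (lookup q s ⊆? lookup p t) (proj₁ (both t s))) ,
  (λ t s → T-⇒⁻ (toℕ t ℕ.≤? toℕ s) (lookup p t ⊆? lookup q s) (proj₂ (both t s)))
  where
  both = λ t s → to T-∧ (T-allFin⁻ (T-allFin⁻ h t) s)

precI⁺ : (p q : Vec (Subset n) r) →
         q ≪ p → (∀ t s → toℕ t ≤ toℕ s → lookup p t ⊆ lookup q s) → T (precI p q)
precI⁺ p q h₁ h₂ = T-allFin⁺ λ t → T-allFin⁺ λ s → from T-∧
  ( T-⇒⁺ (toℕ s ℕ.<? toℕ t) (lookup q s ⊆? lookup p t) (h₁ s t)
  , T-⇒⁺ (toℕ t ℕ.≤? toℕ s) (lookup p t ⊆? lookup q s) (h₂ t s))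

precI⇒≼ : (p q : Vec (Subset n) r) → T (precI p q) → p ≼ q
precI⇒≼ p q h t = proj₂ (precI⁻ p q h) t t ℕₚ.≤-refl

module _ (Δ : SimplicialComplex n) where

  isMultichain⁻ : (x : Multichain n r) → T (isMultichain Δ x) →
    (∀ t → T (isFace Δ (lookup x t))) × (∀ t → Nonempty (lookup x t)) × Ascending x
  isMultichain⁻ x h =
    (λ t → proj₁ (entries t)) , (λ t → toWitness (proj₂ (entries t))) ,
    (λ s t → T-⇒⁻ (toℕ s ℕ.≤? toℕ t) (lookup x s ⊆? lookup x t)
      (T-allFin⁻ (T-allFin⁻ (proj₂ (to T-∧ h)) s) t))
    where
    entries = λ t → to T-∧ (T-allFin⁻ (proj₁ (to T-∧ h)) t)

  isMultichain⁺ : (x : Multichain n r) → (∀ t → T (isFace Δ (lookup x t))) →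
    (∀ t → Nonempty (lookup x t)) → Ascending x → T (isMultichain Δ x)
  isMultichain⁺ x face ne asc = from T-∧
    ( T-allFin⁺ (λ t → from T-∧ (face t , fromWitness (ne t)))
    , T-allFin⁺ λ s → T-allFin⁺ λ t → T-⇒⁺ (toℕ s ℕ.≤? toℕ t) (lookup x s ⊆? lookup x t) (asc s t))

-- The order of enumeration

AllPairs-concatMap⁺ : ∀ {R : B → B → Set} (f : A → List B) {xs} →
  All (λ x → AllPairs R (f x)) xs → AllPairs (λ x y → All (λ a → All (R a) (f y)) (f x)) xs →
  AllPairs R (concatMap f xs)
AllPairs-concatMap⁺ f within across =
  AllPairsₚ.concat⁺ (Allₚ.map⁺ within) (AllPairsₚ.map⁺ across)

-- The tail is the primary key of the enumeration: for distinct positions of the tail its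
-- non-containment passes to the whole set, and over one tail `true` comes before `false`.
allSubsets-sorted : ∀ n → AllPairs (λ x y → ¬ x ⊆ y) (allSubsets n)
allSubsets-sorted zero    = [] ∷ []
allSubsets-sorted (suc n) = AllPairs-concatMap⁺ _
  (All.universal (λ s → ((λ h → case-here (h here)) ∷ []) ∷ [] ∷ []) _)
  (AllPairs.map (λ s⊈t → (drop s⊈t ∷ drop s⊈t ∷ []) ∷ (drop s⊈t ∷ drop s⊈t ∷ []) ∷ [])
                (allSubsets-sorted n))
  where
  case-here : ∀ {s : Subset n} → ¬ (zero ∈ false ∷ s)
  case-here ()
  drop : ∀ {a b} {s t : Subset n} → ¬ s ⊆ t → ¬ (a ∷ s ⊆ b ∷ t)
  drop s⊈t h = s⊈t (drop-∷-⊆ h)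

-- The enumeration is lexicographic, so containment already fails at the first entry whose positions
-- in xs differ.
allVecs-sorted : ∀ r {xs : List (Subset n)} → AllPairs (λ x y → ¬ x ⊆ y) xs →
                 AllPairs (λ x y → ¬ x ≼ y) (allVecs r xs)
allVecs-sorted zero    sorted = [] ∷ []
allVecs-sorted (suc r) {xs} sorted = AllPairs-concatMap⁺ _
  (All.universal (λ x → AllPairsₚ.map⁺
    (AllPairs.map (λ v⋠w h → v⋠w (h ∘ suc)) (allVecs-sorted r sorted))) xs)
  (AllPairs.map (λ x⊈y → Allₚ.map⁺ (All.universal (λ v →
    Allₚ.map⁺ (All.universal (λ w h → x⊈y (h zero)) _)) _))
                sorted)

-- The arguments are flipped so that weak chains start at their largest member, in agreement with
-- the order of enumeration.
interlaced : Multichain n r → Multichain n r → Bool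
interlaced x y = precI y x

-- Since ⪯ implies entrywise containment, the hypothesis excludes both x = y and x ⪯ y; only y ⪯ x
-- is left.
adjacent≡precI : (x y : Multichain n r) → ¬ x ≼ y → adjacent x y ≡ precI y x
adjacent≡precI x y x⋠y = T⇔T⇒≡ forth back
  where
  x≢y : T (not ⌊ ≡-dec (≡-dec Boolₚ._≟_) x y ⌋)
  x≢y = fromWitnessFalse {a? = ≡-dec (≡-dec Boolₚ._≟_) x y} (λ { refl → x⋠y λ t → ⊆-refl })
  forth : T (adjacent x y) → T (precI y x)
  forth h with to (T-∨ {precI x y}) (proj₂ (to (T-∧ {not ⌊ ≡-dec (≡-dec Boolₚ._≟_) x y ⌋}) h))
  ... | inj₁ x≺y = contradiction (precI⇒≼ x y x≺y) x⋠y
  ... | inj₂ y≺x = y≺x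
  back : T (precI y x) → T (adjacent x y)
  back h = from T-∧ (x≢y , from (T-∨ {precI x y}) (inj₂ h))

-- Reflexivity of ⪯ at x is exactly that x ascends; the one-sidedness comes from the enumeration and
-- survives filtering.
multichains-directed : (Δ : SimplicialComplex n) (r : ℕ) →
                       Directed adjacent interlaced (multichains Δ r)
multichains-directed {n} Δ r =
  All.map (λ {x} h → to T-≡ (reflexive x (proj₂ (proj₂ (isMultichain⁻ Δ x h)))))
          (Allₚ.all-filter (T? ∘ isMultichain Δ) vecs) ,
  AllPairsₚ.filter⁺ (T? ∘ isMultichain Δ)
    (AllPairs.map (λ {x} {y} x⋠y → adjacent≡precI x y x⋠y , ¬T⇒≡false (x⋠y ∘ precI⇒≼ x y))
                  (allVecs-sorted r (allSubsets-sorted n)))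
  where
  vecs = allVecs r (allSubsets n)
  reflexive : ∀ x → Ascending x → T (precI x x)
  reflexive x asc = precI⁺ x x (λ s t s<t → asc s t (ℕₚ.<⇒≤ s<t)) asc

-- Interlacing with a fixed multichain

above : Subset n → Subset n → Bool
above a y = ⌊ a ⊆? y ⌋

-- Lower bounds are encoded as up-closed predicates. This treats alike the first entry, which need
-- only be nonempty, and the later ones, which must contain some xₜ₋₁.
UpClosed : (Subset n → Bool) → Set
UpClosed u = ∀ {a b} → a ⊆ b → T (u a) → T (u b)

above⁺ : {a b : Subset n} → a ⊆ b → T (above a b)
above⁺ {a = a} {b} a⊆b = fromWitness {a? = a ⊆? b} a⊆b

above⁻ : {a b : Subset n} → T (above a b) → a ⊆ b
above⁻ {a = a} {b} h = toWitness {a? = a ⊆? b} h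

above-upClosed : (a : Subset n) → UpClosed (above a)
above-upClosed a b⊆c h = above⁺ (⊆-trans (above⁻ h) b⊆c)

-- Only consecutive entries are compared, so that a sum over chains can be evaluated one entry at a
-- time.
isChain : (Subset n → Bool) → Vec (Subset n) r → Bool
isChain u []       = true
isChain u (x ∷ xs) = u x ∧ isChain (above x) xs

-- xₜ₋₁ ⊆ yₜ ⊆ bₜ for all t, where u y₁ stands in for the missing lower bound at t = 1.
inBox : (Subset n → Bool) → (x b y : Vec (Subset n) r) → Bool
inBox u []       []       []       = true
inBox u (x ∷ xs) (b ∷ bs) (y ∷ ys) = u y ∧ (⌊ y ⊆? b ⌋ ∧ inBox (above x) xs bs ys)

isChain⁻ : ∀ {u : Subset n → Bool} → UpClosed u → (x : Vec (Subset n) r) →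
           T (isChain u x) → (∀ t → T (u (lookup x t))) × Ascending x
isChain⁻ up []       h = (λ ()) , (λ ())
isChain⁻ {u = u} up (x ∷ xs) h = us , asc
  where
  ux = proj₁ (to T-∧ h)
  IH = isChain⁻ (above-upClosed x) xs (proj₂ (to T-∧ h))
  us : ∀ t → T (u (lookup (x ∷ xs) t))
  us zero    = ux
  us (suc t) = up (above⁻ (proj₁ IH t)) ux
  asc : Ascending (x ∷ xs)
  asc zero    zero    _         = ⊆-refl
  asc zero    (suc t) _         = above⁻ (proj₁ IH t)
  asc (suc s) (suc t) (s≤s s≤t) = proj₂ IH s t s≤t

isChain⁺ : ∀ {u : Subset n → Bool} (x : Vec (Subset n) r) →
           (∀ t → T (u (lookup x t))) → Ascending x → T (isChain u x)
isChain⁺ []       us asc = tt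
isChain⁺ (x ∷ xs) us asc = from T-∧ (us zero ,
  isChain⁺ xs (λ t → above⁺ (asc zero (suc t) z≤n)) (λ s t s≤t → asc (suc s) (suc t) (s≤s s≤t)))

inBox⁻ : ∀ {u : Subset n → Bool} → UpClosed u → (x b y : Vec (Subset n) r) →
         Ascending x → (∀ t → T (u (lookup x t))) → T (inBox u x b y) →
         (∀ t → T (u (lookup y t))) × y ≼ b × x ≪ y
inBox⁻ up [] [] [] asc ux h = (λ ()) , (λ ()) , (λ ())
inBox⁻ {u = u} up (x ∷ xs) (b ∷ bs) (y ∷ ys) asc ux h = uy , y≼b , x≪y
  where
  h′ = to T-∧ (proj₂ (to (T-∧ {u y}) h))
  IH = inBox⁻ (above-upClosed x) xs bs ys (λ s t s≤t → asc (suc s) (suc t) (s≤s s≤t))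
              (λ t → above⁺ (asc zero (suc t) z≤n)) (proj₂ h′)
  uy : ∀ t → T (u (lookup (y ∷ ys) t))
  uy zero    = proj₁ (to T-∧ h)
  uy (suc t) = up (above⁻ (proj₁ IH t)) (ux zero)
  y≼b : (y ∷ ys) ≼ (b ∷ bs)
  y≼b zero    = above⁻ (proj₁ h′)
  y≼b (suc t) = proj₁ (proj₂ IH) t
  x≪y : (x ∷ xs) ≪ (y ∷ ys)
  x≪y zero    (suc t) _         = above⁻ (proj₁ IH t)
  x≪y (suc s) (suc t) (s≤s s<t) = proj₂ (proj₂ IH) s t s<t

inBox⁺ : ∀ {u : Subset n → Bool} (x b y : Vec (Subset n) r) →
         (∀ t → T (u (lookup y t))) → y ≼ b → x ≪ y → T (inBox u x b y)
inBox⁺ []       []       []       uy y≼b x≪y = tt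
inBox⁺ (x ∷ xs) (b ∷ bs) (y ∷ ys) uy y≼b x≪y =
  from T-∧ (uy zero , from T-∧ (above⁺ (y≼b zero) ,
    inBox⁺ xs bs ys (λ t → above⁺ (x≪y zero (suc t) (s≤s z≤n))) (y≼b ∘ suc)
           (λ s t s<t → x≪y (suc s) (suc t) (s≤s s<t))))

isNonempty : Subset n → Bool
isNonempty x = ⌊ nonempty? x ⌋

isNonempty-upClosed : UpClosed (isNonempty {n})
isNonempty-upClosed a⊆b h with toWitness h
... | i , i∈a = fromWitness (i , a⊆b i∈a)

-- Interlacing with y only lowers the upper bound from b to y. Its conditions across different
-- indices come for free through x: for s < t, yₛ ⊆ bₛ ⊆ xₛ ⊆ zₜ and zₛ ⊆ yₛ ⊆ bₛ ⊆ xₛ ⊆ yₜ.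
inBox-restrict : ∀ {u : Subset n → Bool} → UpClosed u → (x b y : Vec (Subset n) r) →
  Ascending x → (∀ t → T (u (lookup x t))) → b ≼ x → T (inBox u x b y) →
  ∀ z → inBox u x b z ∧ interlaced y z ≡ inBox u x y z
inBox-restrict up x b y asc ux b≼x y∈box z = T⇔T⇒≡ forth back
  where
  y-box = inBox⁻ up x b y asc ux y∈box
  y≼b = proj₁ (proj₂ y-box)
  x≪y = proj₂ (proj₂ y-box)
  forth : T (inBox _ x b z ∧ precI z y) → T (inBox _ x y z)
  forth h = inBox⁺ x y z (proj₁ z-box) (precI⇒≼ z y (proj₂ (to T-∧ h))) (proj₂ (proj₂ z-box))
    where z-box = inBox⁻ up x b z asc ux (proj₁ (to T-∧ h))
  back : T (inBox _ x y z) → T (inBox _ x b z ∧ precI z y)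
  back h = from T-∧
    ( inBox⁺ x b z (proj₁ z-box) (λ t → ⊆-trans (z≼y t) (y≼b t)) x≪z
    , precI⁺ z y (λ s t s<t → ⊆-trans (y≼b s) (⊆-trans (b≼x s) (x≪z s t s<t))) z≤y )
    where
    z-box = inBox⁻ up x y z asc ux h
    z≼y = proj₁ (proj₂ z-box)
    x≪z = proj₂ (proj₂ z-box)
    z≤y : ∀ t s → toℕ t ≤ toℕ s → lookup z t ⊆ lookup y s
    z≤y t s t≤s with ℕₚ.m≤n⇒m<n∨m≡n t≤s
    ... | inj₁ t<s = ⊆-trans (z≼y t) (⊆-trans (y≼b t) (⊆-trans (b≼x t) (x≪y t s t<s)))
    ... | inj₂ t≡s with toℕ-injective t≡s
    ...   | refl = z≼y t

-- The first box has x itself as upper bound. There y inherits its faces from x by down-closure, and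
-- it ascends because yₛ ⊆ xₛ ⊆ yₜ for s < t.
isMultichain-interlaced : (Δ : SimplicialComplex n) (x : Multichain n r) → T (isMultichain Δ x) →
  ∀ y → isMultichain Δ y ∧ interlaced x y ≡ inBox isNonempty x x y
isMultichain-interlaced Δ x x-mc y = T⇔T⇒≡ forth back
  where
  facex = proj₁ (isMultichain⁻ Δ x x-mc)
  nex = proj₁ (proj₂ (isMultichain⁻ Δ x x-mc))
  ascx = proj₂ (proj₂ (isMultichain⁻ Δ x x-mc))
  forth : T (isMultichain Δ y ∧ precI y x) → T (inBox isNonempty x x y)
  forth h = inBox⁺ x x y
    (λ t → fromWitness (proj₁ (proj₂ (isMultichain⁻ Δ y (proj₁ (to T-∧ h)))) t))
    (precI⇒≼ y x (proj₂ (to T-∧ h))) (proj₁ (precI⁻ y x (proj₂ (to T-∧ h))))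
  back : T (inBox isNonempty x x y) → T (isMultichain Δ y ∧ precI y x)
  back h = from T-∧
    ( isMultichain⁺ Δ y (λ t → downClosed Δ _ _ (y≼x t) (facex t))
        (λ t → toWitness (proj₁ y-box t)) ascy
    , precI⁺ y x x≪y (λ t s t≤s → ⊆-trans (y≼x t) (ascx t s t≤s)) )
    where
    y-box = inBox⁻ isNonempty-upClosed x x y ascx (λ t → fromWitness (nex t)) h
    y≼x = proj₁ (proj₂ y-box)
    x≪y = proj₂ (proj₂ y-box)
    ascy : Ascending y
    ascy s t s≤t with ℕₚ.m≤n⇒m<n∨m≡n s≤t
    ... | inj₁ s<t = ⊆-trans (y≼x s) (x≪y s t s<t)
    ... | inj₂ s≡t with toℕ-injective s≡t
    ...   | refl = ⊆-refl

-- By down-closure the top entry alone decides whether all entries are faces.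
isMultichain-isChain : (Δ : SimplicialComplex n) (x : Multichain n (suc r)) →
  isMultichain Δ x ≡ isFace Δ (lookup x (fromℕ r)) ∧ isChain isNonempty x
isMultichain-isChain {r = r} Δ x = T⇔T⇒≡ forth back
  where
  forth : T (isMultichain Δ x) → T (isFace Δ (lookup x (fromℕ r)) ∧ isChain isNonempty x)
  forth h = from T-∧ (proj₁ mc (fromℕ r) ,
    isChain⁺ x (λ t → fromWitness (proj₁ (proj₂ mc) t)) (proj₂ (proj₂ mc)))
    where mc = isMultichain⁻ Δ x h
  back : T (isFace Δ (lookup x (fromℕ r)) ∧ isChain isNonempty x) → T (isMultichain Δ x)
  back h = isMultichain⁺ Δ x
    (λ t → downClosed Δ _ _ (proj₂ chain t (fromℕ r) (≤fromℕ t)) (proj₁ (to T-∧ h)))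
    (λ t → toWitness (proj₁ chain t)) (proj₂ chain)
    where chain = isChain⁻ isNonempty-upClosed x (proj₂ (to T-∧ h))

-- Counting weak chains of multichains

∑-allSubsets : ∀ n (f : Subset (suc n) → ℤ) →
  ∑ (allSubsets (suc n)) f ≡ ∑ (allSubsets n) (λ s → f (true ∷ s) + f (false ∷ s))
∑-allSubsets n f = trans (∑-concatMap _ (allSubsets n) f)
  (∑-cong (allSubsets n) λ s → cong (_+_ (f (true ∷ s))) (+-identityʳ (f (false ∷ s))))

-- The zeta transform of the Boolean lattice.
Z : (Subset n → ℤ) → Subset n → ℤ
Z f x = ∑ (allSubsets _) (λ y → ⟦ ⌊ y ⊆? x ⌋ ⟧ * f y)

pow : ℕ → Subset n → ℤ
pow a x = + (a ℕ.^ ∣ x ∣)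

⌊∷⊆?∷⌋ : ∀ a (x y : Subset n) → ⌊ (a ∷ x) ⊆? (true ∷ y) ⌋ ≡ ⌊ x ⊆? y ⌋
⌊∷⊆?∷⌋ true  x y = trans (isYes≗does ((true ∷ x) ⊆? (true ∷ y))) (sym (isYes≗does (x ⊆? y)))
⌊∷⊆?∷⌋ false x y = trans (isYes≗does ((false ∷ x) ⊆? (true ∷ y))) (sym (isYes≗does (x ⊆? y)))

⌊out∷⊆?∷⌋ : ∀ (x y : Subset n) → ⌊ (false ∷ x) ⊆? (false ∷ y) ⌋ ≡ ⌊ x ⊆? y ⌋
⌊out∷⊆?∷⌋ x y = trans (isYes≗does ((false ∷ x) ⊆? (false ∷ y))) (sym (isYes≗does (x ⊆? y)))

-- The binomial theorem: each element of x is either put into y, with weight a, or left out, with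
-- weight 1.
Z-pow : ∀ a (x : Subset n) → Z (pow a) x ≡ pow (suc a) x
Z-pow a [] = refl
Z-pow {suc n} a (b ∷ x) = trans (∑-allSubsets n _) (go b)
  where
  go : ∀ b → ∑ (allSubsets n) (λ s → ⟦ ⌊ (true ∷ s) ⊆? (b ∷ x) ⌋ ⟧ * pow a (true ∷ s)
                                   + ⟦ ⌊ (false ∷ s) ⊆? (b ∷ x) ⌋ ⟧ * pow a (false ∷ s))
             ≡ pow (suc a) (b ∷ x)
  go false = trans
    (∑-cong (allSubsets n) λ s → trans (+-identityˡ _) (cong (λ b → ⟦ b ⟧ * pow a s) (⌊out∷⊆?∷⌋ s x)))
    (Z-pow a x)
  go true = begin
    ∑ (allSubsets n) (λ s → ⟦ ⌊ (true ∷ s) ⊆? (true ∷ x) ⌋ ⟧ * pow a (true ∷ s)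
                          + ⟦ ⌊ (false ∷ s) ⊆? (true ∷ x) ⌋ ⟧ * pow a s)
      ≡⟨ ∑-cong (allSubsets n) term ⟩
    ∑ (allSubsets n) (λ s → + suc a * (⟦ ⌊ s ⊆? x ⌋ ⟧ * pow a s))
      ≡⟨ ∑-*ˡ (+ suc a) (allSubsets n) _ ⟩
    + suc a * Z (pow a) x
      ≡⟨ cong (+ suc a *_) (Z-pow a x) ⟩
    + suc a * pow (suc a) x
      ≡⟨ pos-* (suc a) _ ⟨
    pow (suc a) (true ∷ x)
      ∎
    where
    factor : ∀ i c p → i * (c * p) + i * p ≡ (1ℤ + c) * (i * p)
    factor = solve-∀
    term : ∀ s → ⟦ ⌊ (true ∷ s) ⊆? (true ∷ x) ⌋ ⟧ * pow a (true ∷ s)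
               + ⟦ ⌊ (false ∷ s) ⊆? (true ∷ x) ⌋ ⟧ * pow a s
             ≡ + suc a * (⟦ ⌊ s ⊆? x ⌋ ⟧ * pow a s)
    term s = trans
      (cong₂ _+_ (cong₂ (λ b p → ⟦ b ⟧ * p) (⌊∷⊆?∷⌋ true s x) (pos-* a (a ℕ.^ ∣ s ∣)))
                 (cong (λ b → ⟦ b ⟧ * pow a s) (⌊∷⊆?∷⌋ false s x)))
      (factor ⟦ ⌊ s ⊆? x ⌋ ⟧ (+ a) (pow a s))

Z-cong : ∀ {f g : Subset n → ℤ} → (∀ y → f y ≡ g y) → ∀ x → Z f x ≡ Z g x
Z-cong f≗g x = ∑-cong (allSubsets _) λ y → cong (⟦ ⌊ y ⊆? x ⌋ ⟧ *_) (f≗g y)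

Z-- : ∀ (f g : Subset n → ℤ) x → Z (λ y → f y - g y) x ≡ Z f x - Z g x
Z-- {n} f g x = trans
  (∑-cong (allSubsets n) λ y → distrib ⟦ ⌊ y ⊆? x ⌋ ⟧ (f y) (g y))
  (∑-- (allSubsets n) _ _)
  where
  distrib : ∀ i a b → i * (a - b) ≡ i * a - i * b
  distrib = solve-∀

iterZ : ℕ → (Subset n → ℤ) → Subset n → ℤ
iterZ zero    f = f
iterZ (suc j) f = Z (iterZ j f)

-- With 0^0 = 1 the indicator of nonemptiness is 1^|x| - 0^|x|, and each application of `Z` raises
-- both bases by one.
iterZ-nonempty : ∀ j (x : Subset n) → iterZ j (⟦_⟧ ∘ isNonempty) x ≡ pow (suc j) x - pow j x
iterZ-nonempty zero x rewrite ℕₚ.^-zeroˡ ∣ x ∣ = base x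
  where
  base : ∀ {n} (x : Subset n) → ⟦ isNonempty x ⟧ ≡ 1ℤ - pow 0 x
  base []          = refl
  base (true ∷ x)  = cong ⟦_⟧ (to T-≡ (fromWitness {a? = nonempty? (true ∷ x)} (zero , here)))
  base (false ∷ x) = trans (cong ⟦_⟧ (T⇔T⇒≡ forth back)) (base x)
    where
    forth : T (isNonempty (false ∷ x)) → T (isNonempty x)
    forth h with toWitness {a? = nonempty? (false ∷ x)} h
    ... | suc i , there i∈x = fromWitness {a? = nonempty? x} (i , i∈x)
    back : T (isNonempty x) → T (isNonempty (false ∷ x))
    back h with toWitness {a? = nonempty? x} h
    ... | i , i∈x = fromWitness {a? = nonempty? (false ∷ x)} (suc i , there i∈x)
iterZ-nonempty (suc j) x = begin
  Z (iterZ j (⟦_⟧ ∘ isNonempty)) x      ≡⟨ Z-cong (iterZ-nonempty j) x ⟩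
  Z (λ y → pow (suc j) y - pow j y) x  ≡⟨ Z-- (pow (suc j)) (pow j) x ⟩
  Z (pow (suc j)) x - Z (pow j) x      ≡⟨ cong₂ _-_ (Z-pow (suc j) x) (Z-pow j x) ⟩
  pow (suc (suc j)) x - pow (suc j) x  ∎

-- Here `iterZ j` counts descents of j steps from x that end above y. Summing over y adds one more
-- step, so `Z` is applied j + 1 times to `pow a`.
∑-pow-iterZ : ∀ a j (x : Subset n) →
  ∑ (allSubsets n) (λ y → pow a y * iterZ j (⟦_⟧ ∘ above y) x) ≡ pow (a ℕ.+ suc j) x
∑-pow-iterZ {n} a zero x = begin
  ∑ (allSubsets n) (λ y → pow a y * ⟦ ⌊ y ⊆? x ⌋ ⟧)
    ≡⟨ ∑-cong (allSubsets n) (λ y → *-comm (pow a y) _) ⟩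
  Z (pow a) x
    ≡⟨ Z-pow a x ⟩
  pow (suc a) x
    ≡⟨ cong (λ c → pow c x) (ℕₚ.+-comm 1 a) ⟩
  pow (a ℕ.+ 1) x
    ∎
∑-pow-iterZ {n} a (suc j) x = begin
  ∑ P (λ y → pow a y * ∑ P (λ z → ⟦ ⌊ z ⊆? x ⌋ ⟧ * k y z))
    ≡⟨ ∑-cong P (λ y → ∑-*ˡ (pow a y) P _) ⟨
  ∑ P (λ y → ∑ P (λ z → pow a y * (⟦ ⌊ z ⊆? x ⌋ ⟧ * k y z)))
    ≡⟨ ∑-swap P P _ ⟩
  ∑ P (λ z → ∑ P (λ y → pow a y * (⟦ ⌊ z ⊆? x ⌋ ⟧ * k y z)))
    ≡⟨ ∑-cong P (λ z → ∑-cong P λ y → swap-factors (pow a y) ⟦ ⌊ z ⊆? x ⌋ ⟧ (k y z)) ⟩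
  ∑ P (λ z → ∑ P (λ y → ⟦ ⌊ z ⊆? x ⌋ ⟧ * (pow a y * k y z)))
    ≡⟨ ∑-cong P (λ z → ∑-*ˡ ⟦ ⌊ z ⊆? x ⌋ ⟧ P _) ⟩
  Z (λ z → ∑ P (λ y → pow a y * k y z)) x
    ≡⟨ Z-cong (∑-pow-iterZ a j) x ⟩
  Z (pow (a ℕ.+ suc j)) x
    ≡⟨ Z-pow (a ℕ.+ suc j) x ⟩
  pow (suc (a ℕ.+ suc j)) x
    ≡⟨ cong (λ c → pow c x) (ℕₚ.+-suc a (suc j)) ⟨
  pow (a ℕ.+ suc (suc j)) x
    ∎
  where
  P = allSubsets n
  k : Subset n → Subset n → ℤ
  k y = iterZ j (⟦_⟧ ∘ above y)
  swap-factors : ∀ a b c → a * (b * c) ≡ b * (a * c)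
  swap-factors = solve-∀

-- Counts the sequences b ⊇ y₁ ⊇ … ⊇ yⱼ of sets satisfying u.
descents : ℕ → (Subset n → Bool) → Subset n → ℤ
descents zero    u b = 1ℤ
descents (suc j) u b = Z (λ y → ⟦ u y ⟧ * descents j u y) b

boxDescents : ℕ → (Subset n → Bool) → (x b : Vec (Subset n) r) → ℤ
boxDescents j u []       []       = 1ℤ
boxDescents j u (x ∷ xs) (b ∷ bs) = descents j u b * boxDescents j (above x) xs bs

-- The conditions on the entries of y are independent, so the sum factors; in each factor, yₜ
-- becomes the first term of a longer descending sequence from bₜ.
∑-inBox : ∀ j (u : Subset n → Bool) (x b : Vec (Subset n) r) →
  ∑ (allVecs r (allSubsets n)) (λ y → ⟦ inBox u x b y ⟧ * boxDescents j u x y)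
    ≡ boxDescents (suc j) u x b
∑-inBox j u []       []       = refl
∑-inBox {n} {suc r} j u (x ∷ xs) (b ∷ bs) = begin
  ∑ (allVecs (suc r) P) (λ y → ⟦ inBox u (x ∷ xs) (b ∷ bs) y ⟧ * boxDescents j u (x ∷ xs) y)
    ≡⟨ ∑-allVecs r P _ ⟩
  ∑ P (λ y → ∑ V (λ ys → ⟦ u y ∧ (⌊ y ⊆? b ⌋ ∧ inBox (above x) xs bs ys) ⟧
                         * (descents j u y * boxDescents j (above x) xs ys)))
    ≡⟨ ∑-cong P (λ y → ∑-cong V λ ys → split y ys) ⟩
  ∑ P (λ y → ∑ V (λ ys → first y * rest ys))
    ≡⟨ ∑-cong P (λ y → ∑-*ˡ (first y) V rest) ⟩
  ∑ P (λ y → first y * ∑ V rest)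
    ≡⟨ ∑-*ʳ (∑ V rest) P first ⟩
  descents (suc j) u b * ∑ V rest
    ≡⟨ cong (descents (suc j) u b *_) (∑-inBox j (above x) xs bs) ⟩
  boxDescents (suc j) u (x ∷ xs) (b ∷ bs)
    ∎
  where
  P = allSubsets n
  V = allVecs r P
  first : Subset n → ℤ
  first y = ⟦ ⌊ y ⊆? b ⌋ ⟧ * (⟦ u y ⟧ * descents j u y)
  rest : Vec (Subset n) r → ℤ
  rest ys = ⟦ inBox (above x) xs bs ys ⟧ * boxDescents j (above x) xs ys
  regroup : ∀ p q s t w → p * (q * s) * (t * w) ≡ q * (p * t) * (s * w)
  regroup = solve-∀
  split : ∀ y ys → ⟦ u y ∧ (⌊ y ⊆? b ⌋ ∧ inBox (above x) xs bs ys) ⟧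
                   * (descents j u y * boxDescents j (above x) xs ys) ≡ first y * rest ys
  split y ys rewrite ⟦⟧-∧ (u y) (⌊ y ⊆? b ⌋ ∧ inBox (above x) xs bs ys)
                   | ⟦⟧-∧ ⌊ y ⊆? b ⌋ (inBox (above x) xs bs ys) =
    regroup ⟦ u y ⟧ ⟦ ⌊ y ⊆? b ⌋ ⟧ ⟦ inBox (above x) xs bs ys ⟧ (descents j u y) _

-- Choosing y replaces the upper bound b by y and keeps the lower bounds given by x, so the box
-- shape is invariant. The predicate p is kept general because successive filters accumulate
-- conjunctions.
weakChains-inBox : ∀ j {u : Subset n → Bool} → UpClosed u → (x b : Vec (Subset n) r) →
  Ascending x → (∀ t → T (u (lookup x t))) → b ≼ x →
  ∀ {p} → (∀ y → p y ≡ inBox u x b y) →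
  weakChains interlaced (filterᵇ p (allVecs r (allSubsets n))) j ≡ boxDescents j u x b
weakChains-inBox zero {u} up x b asc ux b≼x p≗ = sym (boxDescents-zero u x b)
  where
  boxDescents-zero : ∀ {r} u (x b : Vec (Subset _) r) → boxDescents 0 u x b ≡ 1ℤ
  boxDescents-zero u []       []       = refl
  boxDescents-zero u (x ∷ xs) (b ∷ bs) = trans (*-identityˡ _) (boxDescents-zero (above x) xs bs)
weakChains-inBox {n} {r} (suc j) {u} up x b asc ux b≼x {p} p≗ = begin
  ∑ (filterᵇ p V) next
    ≡⟨ ∑-filterᵇ p V _ ⟩
  ∑ V (λ y → ⟦ p y ⟧ * next y)
    ≡⟨ ∑-cong V (λ y → trans (cong (λ c → ⟦ c ⟧ * next y) (p≗ y))
                             (⟦⟧-*-cong (inBox u x b y) (below y))) ⟩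
  ∑ V (λ y → ⟦ inBox u x b y ⟧ * boxDescents j u x y)
    ≡⟨ ∑-inBox j u x b ⟩
  boxDescents (suc j) u x b
    ∎
  where
  V = allVecs r (allSubsets n)
  next : Vec (Subset n) r → ℤ
  next y = weakChains interlaced (filterᵇ (interlaced y) (filterᵇ p V)) j
  below : ∀ y → inBox u x b y ≡ true → next y ≡ boxDescents j u x y
  below y y∈box = trans
    (cong (λ L → weakChains interlaced L j) (filterᵇ-filterᵇ p (interlaced y) V))
    (weakChains-inBox j up x y asc ux
      (λ t → ⊆-trans (proj₁ (proj₂ (inBox⁻ up x b y asc ux (from T-≡ y∈box))) t) (b≼x t))
      (λ z → trans (cong (_∧ interlaced y z) (p≗ z))
                   (inBox-restrict up x b y asc ux b≼x (from T-≡ y∈box) z)))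

-- If u fails at b, up-closure makes it fail at every subset of b.
iterZ-outside : ∀ j {u : Subset n → Bool} → UpClosed u → ∀ b →
                u b ≡ false → iterZ j (⟦_⟧ ∘ u) b ≡ 0ℤ
iterZ-outside zero    up b ub≡f = cong ⟦_⟧ ub≡f
iterZ-outside {n} (suc j) {u} up b ub≡f = trans
  (∑-cong (allSubsets n) λ y → trans (⟦⟧-*-cong ⌊ y ⊆? b ⌋ (vanish y)) (*-zeroʳ ⟦ ⌊ y ⊆? b ⌋ ⟧))
  (∑-zero (allSubsets n))
  where
  vanish : ∀ y → ⌊ y ⊆? b ⌋ ≡ true → iterZ j (⟦_⟧ ∘ u) y ≡ 0ℤ
  vanish y y⊆b = iterZ-outside j up y (¬T⇒≡false λ uy →
    subst T ub≡f (up (above⁻ (from T-≡ y⊆b)) uy))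

-- In a descending sequence it is enough to test u on the last and smallest set; up-closure gives
-- the rest.
descents-iterZ : ∀ j {u : Subset n → Bool} → UpClosed u → ∀ b →
                 ⟦ u b ⟧ * descents j u b ≡ iterZ j (⟦_⟧ ∘ u) b
descents-iterZ zero    up b = *-identityʳ _
descents-iterZ (suc j) {u} up b = trans
  (cong (⟦ u b ⟧ *_) (Z-cong (descents-iterZ j up) b)) (absorb (u b) refl)
  where
  absorb : ∀ c → u b ≡ c → ⟦ c ⟧ * iterZ (suc j) (⟦_⟧ ∘ u) b ≡ iterZ (suc j) (⟦_⟧ ∘ u) b
  absorb true  _    = *-identityˡ _
  absorb false ub≡f = sym (iterZ-outside (suc j) up b ub≡f)

-- The number of box descents from x to which x contributes, with the chain condition absorbed into
-- the factors; it vanishes unless x is a chain above u.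
chainWeight : ℕ → (Subset n → Bool) → Vec (Subset n) r → ℤ
chainWeight j u []       = 1ℤ
chainWeight j u (x ∷ xs) = iterZ j (⟦_⟧ ∘ u) x * chainWeight j (above x) xs

isChain-boxDescents : ∀ j {u : Subset n → Bool} → UpClosed u → (x : Vec (Subset n) r) →
  ⟦ isChain u x ⟧ * boxDescents j u x x ≡ chainWeight j u x
isChain-boxDescents j up [] = refl
isChain-boxDescents j {u} up (x ∷ xs) = begin
  ⟦ u x ∧ isChain (above x) xs ⟧ * (descents j u x * boxDescents j (above x) xs xs)
    ≡⟨ cong (_* (descents j u x * boxDescents j (above x) xs xs)) (⟦⟧-∧ (u x) (isChain (above x) xs)) ⟩
  ⟦ u x ⟧ * ⟦ isChain (above x) xs ⟧ * (descents j u x * boxDescents j (above x) xs xs)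
    ≡⟨ regroup ⟦ u x ⟧ ⟦ isChain (above x) xs ⟧ (descents j u x) _ ⟩
  ⟦ u x ⟧ * descents j u x * (⟦ isChain (above x) xs ⟧ * boxDescents j (above x) xs xs)
    ≡⟨ cong₂ _*_ (descents-iterZ j up x) (isChain-boxDescents j (above-upClosed x) xs) ⟩
  chainWeight j u (x ∷ xs)
    ∎
  where
  regroup : ∀ p q s t → p * q * (s * t) ≡ p * s * (q * t)
  regroup = solve-∀

-- `chainWeight` with its first factor replaced by a power; this form is preserved when the first
-- entry is summed out.
powWeight : ℕ → ℕ → Vec (Subset n) (suc r) → ℤ
powWeight j a (x ∷ xs) = pow a x * chainWeight j (above x) xs

-- Summing out the smallest entry raises the base by j + 1. After r such steps only the top entry,
-- the one tested by F, remains.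
∑-powWeight : ∀ r j a (F : Subset n → Bool) →
  ∑ (allVecs (suc r) (allSubsets n)) (λ v → ⟦ F (lookup v (fromℕ r)) ⟧ * powWeight j a v)
    ≡ ∑ (allSubsets n) (λ x → ⟦ F x ⟧ * pow (a ℕ.+ r ℕ.* suc j) x)
∑-powWeight {n} zero j a F = trans (∑-allVecs 0 (allSubsets n) _) (∑-cong (allSubsets n) λ x → begin
  ⟦ F x ⟧ * (pow a x * 1ℤ) + 0ℤ   ≡⟨ +-identityʳ _ ⟩
  ⟦ F x ⟧ * (pow a x * 1ℤ)        ≡⟨ cong (⟦ F x ⟧ *_) (*-identityʳ _) ⟩
  ⟦ F x ⟧ * pow a x               ≡⟨ cong (λ c → ⟦ F x ⟧ * pow c x) (ℕₚ.+-identityʳ a) ⟨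
  ⟦ F x ⟧ * pow (a ℕ.+ 0) x       ∎)
∑-powWeight {n} (suc r) j a F = begin
  ∑ (allVecs (suc (suc r)) P) (λ v → ⟦ F (lookup v (fromℕ (suc r))) ⟧ * powWeight j a v)
    ≡⟨ ∑-allVecs (suc r) P _ ⟩
  ∑ P (λ x → ∑ V (λ v → ⟦ F (top v) ⟧ * (pow a x * chainWeight j (above x) v)))
    ≡⟨ ∑-swap P V _ ⟩
  ∑ V (λ v → ∑ P (λ x → ⟦ F (top v) ⟧ * (pow a x * chainWeight j (above x) v)))
    ≡⟨ ∑-cong V (λ v → trans (∑-*ˡ ⟦ F (top v) ⟧ P _) (cong (⟦ F (top v) ⟧ *_) (absorb v))) ⟩
  ∑ V (λ v → ⟦ F (top v) ⟧ * powWeight j (a ℕ.+ suc j) v)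
    ≡⟨ ∑-powWeight r j (a ℕ.+ suc j) F ⟩
  ∑ P (λ x → ⟦ F x ⟧ * pow (a ℕ.+ suc j ℕ.+ r ℕ.* suc j) x)
    ≡⟨ ∑-cong P (λ x → cong (λ c → ⟦ F x ⟧ * pow c x) (ℕₚ.+-assoc a (suc j) _)) ⟩
  ∑ P (λ x → ⟦ F x ⟧ * pow (a ℕ.+ suc r ℕ.* suc j) x)
    ∎
  where
  P = allSubsets n
  V = allVecs (suc r) P
  top : Vec (Subset n) (suc r) → Subset n
  top v = lookup v (fromℕ r)
  absorb : ∀ v → ∑ P (λ x → pow a x * chainWeight j (above x) v) ≡ powWeight j (a ℕ.+ suc j) v
  absorb (y ∷ ys) = begin
    ∑ P (λ x → pow a x * (iterZ j (⟦_⟧ ∘ above x) y * c))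
      ≡⟨ ∑-cong P (λ x → *-assoc (pow a x) (iterZ j (⟦_⟧ ∘ above x) y) c) ⟨
    ∑ P (λ x → pow a x * iterZ j (⟦_⟧ ∘ above x) y * c)
      ≡⟨ ∑-*ʳ c P _ ⟩
    ∑ P (λ x → pow a x * iterZ j (⟦_⟧ ∘ above x) y) * c
      ≡⟨ cong (_* c) (∑-pow-iterZ a j y) ⟩
    pow (a ℕ.+ suc j) y * c
      ∎
    where c = chainWeight j (above y) ys

weakChains-multichains : (Δ : SimplicialComplex n) (r i : ℕ) →
  weakChains interlaced (multichains Δ (suc r)) (suc i) ≡
  ∑ (allSubsets n) (λ σ → ⟦ isFace Δ σ ⟧ * (pow (suc r ℕ.* suc i) σ - pow (suc r ℕ.* suc i ∸ 1) σ))
weakChains-multichains {n} Δ r i = begin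
  ∑ (multichains Δ (suc r)) next
    ≡⟨ ∑-filterᵇ (isMultichain Δ) V _ ⟩
  ∑ V (λ x → ⟦ isMultichain Δ x ⟧ * next x)
    ≡⟨ ∑-cong V (λ x → ⟦⟧-*-cong (isMultichain Δ x) (below x ∘ from T-≡)) ⟩
  ∑ V (λ x → ⟦ isMultichain Δ x ⟧ * boxDescents i isNonempty x x)
    ≡⟨ ∑-cong V weight ⟩
  ∑ V (λ x → ⟦ F (top x) ⟧ * powWeight i (suc i) x - ⟦ F (top x) ⟧ * powWeight i i x)
    ≡⟨ ∑-- V _ _ ⟩
  ∑ V (λ x → ⟦ F (top x) ⟧ * powWeight i (suc i) x) - ∑ V (λ x → ⟦ F (top x) ⟧ * powWeight i i x)
    -- The bases are (i + 1) + r (i + 1) = (r + 1)(i + 1) and i + r (i + 1), one less; both agree by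
    -- computation.
    ≡⟨ cong₂ _-_ (∑-powWeight r i (suc i) F) (∑-powWeight r i i F) ⟩
  ∑ P (λ σ → ⟦ F σ ⟧ * pow (suc r ℕ.* suc i) σ) - ∑ P (λ σ → ⟦ F σ ⟧ * pow (suc r ℕ.* suc i ∸ 1) σ)
    ≡⟨ ∑-- P _ _ ⟨
  ∑ P (λ σ → ⟦ F σ ⟧ * pow (suc r ℕ.* suc i) σ - ⟦ F σ ⟧ * pow (suc r ℕ.* suc i ∸ 1) σ)
    ≡⟨ ∑-cong P (λ σ → factor ⟦ F σ ⟧ _ _) ⟩
  ∑ P (λ σ → ⟦ F σ ⟧ * (pow (suc r ℕ.* suc i) σ - pow (suc r ℕ.* suc i ∸ 1) σ))
    ∎
  where
  P = allSubsets n
  V = allVecs (suc r) P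
  F = isFace Δ
  top : Vec (Subset n) (suc r) → Subset n
  top v = lookup v (fromℕ r)
  factor : ∀ i a b → i * a - i * b ≡ i * (a - b)
  factor = solve-∀
  next : Multichain n (suc r) → ℤ
  next x = weakChains interlaced (filterᵇ (interlaced x) (multichains Δ (suc r))) i
  below : ∀ x → T (isMultichain Δ x) → next x ≡ boxDescents i isNonempty x x
  below x mc = trans
    (cong (λ L → weakChains interlaced L i) (filterᵇ-filterᵇ (isMultichain Δ) (interlaced x) V))
    (weakChains-inBox i isNonempty-upClosed x x asc (λ t → fromWitness (ne t)) (λ t → ⊆-refl)
      (isMultichain-interlaced Δ x mc))
    where
    ne = proj₁ (proj₂ (isMultichain⁻ Δ x mc))
    asc = proj₂ (proj₂ (isMultichain⁻ Δ x mc))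
  expand : ∀ f a b c → f * ((a - b) * c) ≡ f * (a * c) - f * (b * c)
  expand = solve-∀
  weight : ∀ x → ⟦ isMultichain Δ x ⟧ * boxDescents i isNonempty x x
               ≡ ⟦ F (top x) ⟧ * powWeight i (suc i) x - ⟦ F (top x) ⟧ * powWeight i i x
  weight x@(y ∷ ys) = begin
    ⟦ isMultichain Δ x ⟧ * boxDescents i isNonempty x x
      ≡⟨ cong (λ b → ⟦ b ⟧ * boxDescents i isNonempty x x) (isMultichain-isChain Δ x) ⟩
    ⟦ F (top x) ∧ isChain isNonempty x ⟧ * boxDescents i isNonempty x x
      ≡⟨ cong (_* boxDescents i isNonempty x x) (⟦⟧-∧ (F (top x)) (isChain isNonempty x)) ⟩
    ⟦ F (top x) ⟧ * ⟦ isChain isNonempty x ⟧ * boxDescents i isNonempty x x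
      ≡⟨ *-assoc ⟦ F (top x) ⟧ ⟦ isChain isNonempty x ⟧ _ ⟩
    ⟦ F (top x) ⟧ * (⟦ isChain isNonempty x ⟧ * boxDescents i isNonempty x x)
      ≡⟨ cong (⟦ F (top x) ⟧ *_) (isChain-boxDescents i isNonempty-upClosed x) ⟩
    ⟦ F (top x) ⟧ * (iterZ i (⟦_⟧ ∘ isNonempty) y * chainWeight i (above y) ys)
      ≡⟨ cong (λ w → ⟦ F (top x) ⟧ * (w * chainWeight i (above y) ys)) (iterZ-nonempty i y) ⟩
    ⟦ F (top x) ⟧ * ((pow (suc i) y - pow i y) * chainWeight i (above y) ys)
      ≡⟨ expand ⟦ F (top x) ⟧ (pow (suc i) y) (pow i y) _ ⟩
    ⟦ F (top x) ⟧ * powWeight i (suc i) x - ⟦ F (top x) ⟧ * powWeight i i x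
      ∎

-- Inverting the differences

sumTo-cong : ∀ m {g h : ℕ → ℤ} → (∀ i → i ≤ m → g i ≡ h i) → sumTo m g ≡ sumTo m h
sumTo-cong zero    g≗h = g≗h 0 z≤n
sumTo-cong (suc m) g≗h =
  cong₂ _+_ (sumTo-cong m λ i i≤m → g≗h i (ℕₚ.m≤n⇒m≤1+n i≤m)) (g≗h (suc m) ℕₚ.≤-refl)

sumTo-head : ∀ m (g : ℕ → ℤ) → sumTo (suc m) g ≡ g 0 + sumTo m (g ∘ suc)
sumTo-head zero    g = refl
sumTo-head (suc m) g = trans (cong (_+ g (suc (suc m))) (sumTo-head m g)) (+-assoc (g 0) _ _)

sumTo-+ : ∀ m (g h : ℕ → ℤ) → sumTo m (λ i → g i + h i) ≡ sumTo m g + sumTo m h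
sumTo-+ zero    g h = refl
sumTo-+ (suc m) g h = trans (cong (_+ (g (suc m) + h (suc m))) (sumTo-+ m g h))
  (interchange (sumTo m g) (sumTo m h) (g (suc m)) (h (suc m)))
  where
  interchange : ∀ a b c d → a + b + (c + d) ≡ a + c + (b + d)
  interchange = solve-∀

sumTo-- : ∀ m (g h : ℕ → ℤ) → sumTo m (λ i → g i - h i) ≡ sumTo m g - sumTo m h
sumTo-- zero    g h = refl
sumTo-- (suc m) g h = trans (cong (_+ (g (suc m) - h (suc m))) (sumTo-- m g h))
  (interchange (sumTo m g) (sumTo m h) (g (suc m)) (h (suc m)))
  where
  interchange : ∀ a b c d → a - b + (c - d) ≡ a + c - (b + d)
  interchange = solve-∀

sumTo-*ˡ : ∀ c m (g : ℕ → ℤ) → sumTo m (λ i → c * g i) ≡ c * sumTo m g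
sumTo-*ˡ c zero    g = refl
sumTo-*ˡ c (suc m) g = trans
  (cong (_+ c * g (suc m)) (sumTo-*ˡ c m g))
  (sym (*-distribˡ-+ c _ (g (suc m))))

sumTo-zero : ∀ m {g : ℕ → ℤ} → (∀ i → i ≤ m → g i ≡ 0ℤ) → sumTo m g ≡ 0ℤ
sumTo-zero zero    g≗0 = g≗0 0 z≤n
sumTo-zero (suc m) g≗0 =
  cong₂ _+_ (sumTo-zero m λ i i≤m → g≗0 i (ℕₚ.m≤n⇒m≤1+n i≤m)) (g≗0 (suc m) ℕₚ.≤-refl)

sumTo-swap : ∀ m k (g : ℕ → ℕ → ℤ) →
             sumTo m (λ l → sumTo k (g l)) ≡ sumTo k (λ i → sumTo m (λ l → g l i))
sumTo-swap zero    k g = refl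
sumTo-swap (suc m) k g = trans (cong (_+ sumTo k (g (suc m))) (sumTo-swap m k g))
                               (sym (sumTo-+ k (λ i → sumTo m (λ l → g l i)) (g (suc m))))

sumTo-∑ : ∀ {A : Set} m (xs : List A) (g : ℕ → A → ℤ) →
          sumTo m (λ l → ∑ xs (g l)) ≡ ∑ xs (λ x → sumTo m (λ l → g l x))
sumTo-∑ zero    xs g = refl
sumTo-∑ (suc m) xs g = trans (cong (_+ ∑ xs (g (suc m))) (sumTo-∑ m xs g))
                             (sym (∑-+ xs _ (g (suc m))))

signedC : ℕ → ℕ → ℤ
signedC k i = (- (+ 1)) ^ (k ∸ i) * + (k C i)

-- Pascal's rule; the minus sign appears because k - i exceeds k - (i + 1) by one.
signedC-suc : ∀ k i → i ≤ k → signedC (suc k) (suc i) ≡ signedC k i - signedC k (suc i)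
signedC-suc k i i≤k = begin
  s * + (suc k C suc i)
    ≡⟨ cong (λ c → s * + c) (nCk+nC[k+1]≡[n+1]C[k+1] k i) ⟨
  s * + (k C i ℕ.+ k C suc i)
    ≡⟨ cong (s *_) (pos-+ (k C i) (k C suc i)) ⟩
  s * (+ (k C i) + + (k C suc i))
    ≡⟨ *-distribˡ-+ s (+ (k C i)) (+ (k C suc i)) ⟩
  s * + (k C i) + s * + (k C suc i)
    ≡⟨ cong (_+_ (signedC k i)) (flip-sign (ℕₚ.m≤n⇒m<n∨m≡n i≤k)) ⟩
  signedC k i - signedC k (suc i)
    ∎
  where
  s = (- (+ 1)) ^ (k ∸ i)
  negate : ∀ a c → -1ℤ * a * c ≡ - (a * c)
  negate a c = trans (cong (_* c) (-1*i≡-i a)) (sym (neg-distribˡ-* a c))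
  flip-sign : i < k ⊎ i ≡ k → s * + (k C suc i) ≡ - signedC k (suc i)
  flip-sign (inj₁ i<k) = trans
    (cong (λ e → (- (+ 1)) ^ e * + (k C suc i)) (ℕₚ.+-∸-assoc 1 i<k))
    (negate ((- (+ 1)) ^ (k ∸ suc i)) (+ (k C suc i)))
  -- At i = k truncated subtraction gives no change of sign, but the binomial coefficient of k over
  -- k + 1 is zero.
  flip-sign (inj₂ refl) rewrite k>n⇒nCk≡0 (ℕₚ.n<1+n k) | *-zeroʳ ((- (+ 1)) ^ (k ∸ suc k)) =
    *-zeroʳ s

-- The expansion of (S - 1)^k for the shift S, by induction through Pascal's rule.
diff₀-signedC : ∀ k (g : ℕ → ℤ) → diff₀ k g ≡ sumTo k (λ i → signedC k i * g i)
diff₀-signedC zero    g = sym (*-identityˡ (g 0))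
diff₀-signedC (suc k) g = begin
  diff₀ k (λ i → g (suc i) - g i)
    ≡⟨ diff₀-signedC k _ ⟩
  sumTo k (λ i → c i * (g (suc i) - g i))
    ≡⟨ sumTo-cong k (λ i _ → *-distribˡ-- (c i) (g (suc i)) (g i)) ⟩
  sumTo k (λ i → c i * g (suc i) - c i * g i)
    ≡⟨ sumTo-- k _ _ ⟩
  sumTo k (λ i → c i * g (suc i)) - sumTo k (λ i → c i * g i)
    -- A zero term at i = k + 1 is added, so that splitting off i = 0 leaves a sum over the same
    -- range as the other one.
    ≡⟨ cong (λ z → sumTo k (λ i → c i * g (suc i)) - z) (sym extend) ⟩
  sumTo k (λ i → c i * g (suc i)) - sumTo (suc k) (λ i → c i * g i)
    ≡⟨ cong (λ z → sumTo k (λ i → c i * g (suc i)) - z) (sumTo-head k _) ⟩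
  sumTo k (λ i → c i * g (suc i)) - (c 0 * g 0 + sumTo k (λ i → c (suc i) * g (suc i)))
    ≡⟨ rearrange (sumTo k (λ i → c i * g (suc i))) (c 0 * g 0) _ ⟩
  - (c 0 * g 0) + (sumTo k (λ i → c i * g (suc i)) - sumTo k (λ i → c (suc i) * g (suc i)))
    ≡⟨ cong₂ _+_ first (sym (sumTo-- k _ _)) ⟩
  signedC (suc k) 0 * g 0 + sumTo k (λ i → c i * g (suc i) - c (suc i) * g (suc i))
    ≡⟨ cong (_+_ (signedC (suc k) 0 * g 0)) (sumTo-cong k rest) ⟩
  signedC (suc k) 0 * g 0 + sumTo k (λ i → signedC (suc k) (suc i) * g (suc i))
    ≡⟨ sumTo-head k _ ⟨
  sumTo (suc k) (λ i → signedC (suc k) i * g i)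
    ∎
  where
  c = signedC k
  *-distribˡ-- : ∀ a b d → a * (b - d) ≡ a * b - a * d
  *-distribˡ-- = solve-∀
  *-distribʳ-- : ∀ a b d → (b - d) * a ≡ b * a - d * a
  *-distribʳ-- = solve-∀
  rearrange : ∀ a b d → a - (b + d) ≡ - b + (a - d)
  rearrange = solve-∀
  extend : sumTo (suc k) (λ i → c i * g i) ≡ sumTo k (λ i → c i * g i)
  extend rewrite k>n⇒nCk≡0 (ℕₚ.n<1+n k) | *-zeroʳ ((- (+ 1)) ^ (k ∸ suc k)) = +-identityʳ _
  negate : ∀ s x → - (s * 1ℤ * x) ≡ (- 1ℤ) * s * 1ℤ * x
  negate = solve-∀
  first : - (c 0 * g 0) ≡ signedC (suc k) 0 * g 0
  first = negate ((- (+ 1)) ^ k) (g 0)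
  rest : ∀ i → i ≤ k → c i * g (suc i) - c (suc i) * g (suc i) ≡ signedC (suc k) (suc i) * g (suc i)
  rest i i≤k = trans (sym (*-distribʳ-- (g (suc i)) (c i) (c (suc i))))
                     (cong (_* g (suc i)) (sym (signedC-suc k i i≤k)))

-- Grouping faces by cardinality

⌊⌋≡false : ∀ {P : Set} (p? : Dec P) → ¬ P → ⌊ p? ⌋ ≡ false
⌊⌋≡false p? ¬p = ¬T⇒≡false (¬p ∘ toWitness)

sumTo-indicator : ∀ d m (f : ℕ → ℤ) → m ≤ d → sumTo d (λ l → f l * ⟦ ⌊ m ℕ.≟ l ⌋ ⟧) ≡ f m
sumTo-indicator zero    zero    f z≤n = *-identityʳ (f 0)
sumTo-indicator (suc d) m f m≤1+d with ℕₚ.m≤n⇒m<n∨m≡n m≤1+d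
... | inj₁ (s≤s m≤d) = begin
  sumTo d (λ l → f l * ⟦ ⌊ m ℕ.≟ l ⌋ ⟧) + f (suc d) * ⟦ ⌊ m ℕ.≟ suc d ⌋ ⟧
    ≡⟨ cong₂ (λ s b → s + f (suc d) * ⟦ b ⟧) (sumTo-indicator d m f m≤d)
             (⌊⌋≡false (m ℕ.≟ suc d) (ℕₚ.<⇒≢ (s≤s m≤d))) ⟩
  f m + f (suc d) * 0ℤ
    ≡⟨ cong (_+_ (f m)) (*-zeroʳ (f (suc d))) ⟩
  f m + 0ℤ
    ≡⟨ +-identityʳ (f m) ⟩
  f m ∎
... | inj₂ refl = begin
  sumTo d (λ l → f l * ⟦ ⌊ suc d ℕ.≟ l ⌋ ⟧) + f (suc d) * ⟦ ⌊ suc d ℕ.≟ suc d ⌋ ⟧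
    ≡⟨ cong₂ (λ s b → s + f (suc d) * ⟦ b ⟧)
             (sumTo-zero d λ l l≤d → trans
               (cong (λ b → f l * ⟦ b ⟧) (⌊⌋≡false (suc d ℕ.≟ l) (ℕₚ.<⇒≢ (s≤s l≤d) ∘ sym)))
               (*-zeroʳ (f l)))
             (to T-≡ (fromWitness {a? = suc d ℕ.≟ suc d} refl)) ⟩
  0ℤ + f (suc d) * 1ℤ
    ≡⟨ trans (+-identityˡ _) (*-identityʳ (f (suc d))) ⟩
  f (suc d) ∎

-- Each face is counted at l = |σ| only, and the dimension bound puts this l within the range of
-- summation.
∑-faces : (Δ : SimplicialComplex n) (d : ℕ) → (∀ σ → T (isFace Δ σ) → ∣ σ ∣ ≤ d) → ∀ (f : ℕ → ℤ) →
  ∑ (allSubsets n) (λ σ → ⟦ isFace Δ σ ⟧ * f ∣ σ ∣) ≡ sumTo d (λ l → f l * + fCard Δ l)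
∑-faces {n} Δ d bound f = sym (begin
  sumTo d (λ l → f l * + fCard Δ l)
    ≡⟨ sumTo-cong d (λ l _ → trans (cong (f l *_) (count-∑ _ P)) (sym (∑-*ˡ (f l) P _))) ⟩
  sumTo d (λ l → ∑ P (λ σ → f l * ⟦ isFace Δ σ ∧ ⌊ ∣ σ ∣ ℕ.≟ l ⌋ ⟧))
    ≡⟨ sumTo-∑ d P _ ⟩
  ∑ P (λ σ → sumTo d (λ l → f l * ⟦ isFace Δ σ ∧ ⌊ ∣ σ ∣ ℕ.≟ l ⌋ ⟧))
    ≡⟨ ∑-cong P collect ⟩
  ∑ P (λ σ → ⟦ isFace Δ σ ⟧ * f ∣ σ ∣)
    ∎)
  where
  P = allSubsets n
  swap-factors : ∀ a b c → a * (b * c) ≡ b * (a * c)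
  swap-factors = solve-∀
  collect : ∀ σ → sumTo d (λ l → f l * ⟦ isFace Δ σ ∧ ⌊ ∣ σ ∣ ℕ.≟ l ⌋ ⟧) ≡ ⟦ isFace Δ σ ⟧ * f ∣ σ ∣
  collect σ = begin
    sumTo d (λ l → f l * ⟦ isFace Δ σ ∧ ⌊ ∣ σ ∣ ℕ.≟ l ⌋ ⟧)
      ≡⟨ sumTo-cong d (λ l _ → trans (cong (f l *_) (⟦⟧-∧ (isFace Δ σ) ⌊ ∣ σ ∣ ℕ.≟ l ⌋))
                                     (swap-factors (f l) ⟦ isFace Δ σ ⟧ ⟦ ⌊ ∣ σ ∣ ℕ.≟ l ⌋ ⟧)) ⟩
    sumTo d (λ l → ⟦ isFace Δ σ ⟧ * (f l * ⟦ ⌊ ∣ σ ∣ ℕ.≟ l ⌋ ⟧))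
      ≡⟨ sumTo-*ˡ ⟦ isFace Δ σ ⟧ d _ ⟩
    ⟦ isFace Δ σ ⟧ * sumTo d (λ l → f l * ⟦ ⌊ ∣ σ ∣ ℕ.≟ l ⌋ ⟧)
      ≡⟨ ⟦⟧-*-cong (isFace Δ σ) (λ face → sumTo-indicator d ∣ σ ∣ f (bound σ (from T-≡ face))) ⟩
    ⟦ isFace Δ σ ⟧ * f ∣ σ ∣
      ∎

∣p∣≡0⇒p≡⊥ : (p : Subset n) → ∣ p ∣ ≡ 0 → p ≡ ⊥
∣p∣≡0⇒p≡⊥ []          _ = refl
∣p∣≡0⇒p≡⊥ (false ∷ p) e = cong (false ∷_) (∣p∣≡0⇒p≡⊥ p e)

-- The only set of cardinality 0 is the empty one, a face by down-closure from σ. Its subsets are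
-- counted by `Z (pow 1)`, with value 2^0.
fCard-zero : (Δ : SimplicialComplex n) → ∀ {σ} → T (isFace Δ σ) → fCard Δ 0 ≡ 1
fCard-zero {n} Δ {σ} face = +-injective (begin
  + fCard Δ 0
    ≡⟨ count-∑ _ P ⟩
  ∑ P (λ τ → ⟦ isFace Δ τ ∧ ⌊ ∣ τ ∣ ℕ.≟ 0 ⌋ ⟧)
    ≡⟨ ∑-cong P empty ⟩
  ∑ P (λ τ → ⟦ ⌊ τ ⊆? ⊥ ⌋ ⟧ * pow 1 τ)
    ≡⟨ Z-pow 1 (⊥ {n}) ⟩
  pow 2 (⊥ {n})
    ≡⟨ cong (λ m → + (2 ℕ.^ m)) (∣⊥∣≡0 n) ⟩
  1ℤ ∎)
  where
  P = allSubsets n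
  empty : ∀ τ → ⟦ isFace Δ τ ∧ ⌊ ∣ τ ∣ ℕ.≟ 0 ⌋ ⟧ ≡ ⟦ ⌊ τ ⊆? ⊥ ⌋ ⟧ * pow 1 τ
  empty τ rewrite ℕₚ.^-zeroˡ ∣ τ ∣ | *-identityʳ ⟦ ⌊ τ ⊆? ⊥ ⌋ ⟧ = cong ⟦_⟧ (T⇔T⇒≡ forth back)
    where
    forth : T (isFace Δ τ ∧ ⌊ ∣ τ ∣ ℕ.≟ 0 ⌋) → T ⌊ τ ⊆? ⊥ ⌋
    forth h = above⁺ (subst (τ ⊆_)
      (∣p∣≡0⇒p≡⊥ τ (toWitness {a? = ∣ τ ∣ ℕ.≟ 0} (proj₂ (to (T-∧ {isFace Δ τ}) h)))) ⊆-refl)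
    back : T ⌊ τ ⊆? ⊥ ⌋ → T (isFace Δ τ ∧ ⌊ ∣ τ ∣ ℕ.≟ 0 ⌋)
    back h with ⊆-antisym (above⁻ {a = τ} {⊥} h) ⊥⊆
    ... | refl = from (T-∧ {isFace Δ ⊥}) (downClosed Δ σ ⊥ ⊥⊆ face ,
      fromWitness {a? = ∣ ⊥ {n} ∣ ℕ.≟ 0} (∣⊥∣≡0 n))

-- Assembling the face numbers of the clique complex

theorem4p2 : (n : ℕ) (Δ : SimplicialComplex n) (d : ℕ) → HasDimMinusOne Δ d →
    (r : ℕ) → 1 ≤ r →
    ((k : ℕ) → k < d → + fCliqueCard Δ r (suc k) ≡ rhs Δ d r k)
    × (fCliqueCard Δ r 0 ≡ 1 × fCard Δ 0 ≡ 1)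
theorem4p2 n Δ d ((σ , face , _) , bound) (suc r) _ =
  (λ k _ → main k) ,
  +-injective (trans (count-∑ _ (sublists M)) (cliques-zero adjacent M)) ,
  fCard-zero Δ face
  where
  R = suc r
  M = multichains Δ R
  h : ℕ → ℕ → ℤ
  h i l = + ((R ℕ.+ R ℕ.* i) ℕ.^ l) - + ((R ℕ.+ R ℕ.* i ∸ 1) ℕ.^ l)
  weak : ∀ i → weakChains interlaced M (suc i) ≡ sumTo d (λ l → h i l * + fCard Δ l)
  weak i = begin
    weakChains interlaced M (suc i)
      ≡⟨ weakChains-multichains Δ r i ⟩
    ∑ (allSubsets n) (λ τ → ⟦ isFace Δ τ ⟧ * (pow (R ℕ.* suc i) τ - pow (R ℕ.* suc i ∸ 1) τ))
      -- The base R (i + 1) is rewritten as R + R i, the form in which it occurs in `rhs`.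
      ≡⟨ cong (λ N → ∑ (allSubsets n) (λ τ → ⟦ isFace Δ τ ⟧ * (pow N τ - pow (N ∸ 1) τ)))
              (ℕₚ.*-suc R i) ⟩
    ∑ (allSubsets n) (λ τ → ⟦ isFace Δ τ ⟧ * h i ∣ τ ∣)
      ≡⟨ ∑-faces Δ d bound (h i) ⟩
    sumTo d (λ l → h i l * + fCard Δ l)
      ∎
  main : ∀ k → + fCliqueCard Δ R (suc k) ≡ rhs Δ d R k
  main k = begin
    + fCliqueCard Δ R (suc k)
      ≡⟨ count-∑ _ (sublists M) ⟩
    cliques adjacent M (suc k)
      ≡⟨ diff₀-weakChains adjacent interlaced (length M) M ℕₚ.≤-refl (multichains-directed Δ R) k ⟨
    diff₀ k (λ i → weakChains interlaced M (suc i))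
      ≡⟨ diff₀-signedC k _ ⟩
    sumTo k (λ i → signedC k i * weakChains interlaced M (suc i))
      ≡⟨ sumTo-cong k (λ i _ → trans (cong (signedC k i *_) (weak i))
                                     (sym (sumTo-*ˡ (signedC k i) d _))) ⟩
    sumTo k (λ i → sumTo d (λ l → signedC k i * (h i l * + fCard Δ l)))
      ≡⟨ sumTo-cong k (λ i _ → sumTo-cong d (λ l _ → *-assoc (signedC k i) (h i l) (+ fCard Δ l))) ⟨
    sumTo k (λ i → sumTo d (λ l → signedC k i * h i l * + fCard Δ l))
      ≡⟨ sumTo-swap d k _ ⟨
    rhs Δ d R k
      ∎
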